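{- The sets of patterns $\{132,2213\}$ and $\{213,1322\}$ are $m$-equivalent, that is, $\{132,2213\}\sim\{213,1322\}$.
   Context: A (finite, reduced) multiset is $S=1^{a_1}2^{a_2}\cdots k^{a_k}$ with $k\ge 1$ and all $a_i\ge 1$, meaning that $i$ occurs with multiplicity $a_i$. A multipermutation of $S$ is a word having exactly $a_i$ occurrences of each letter $i\in[k]=\{1,\dots,k\}$ and no other letters. A word $\pi=\pi_1\cdots\pi_n$ contains a pattern (word) $\rho=\rho_1\cdots\rho_\ell$ if there are indices $i(1)<\cdots<i(\ell)$ such that for all $a,b\in[\ell]$: $\pi_{i(a)}<\pi_{i(b)}$ iff $\rho_a<\rho_b$, and $\pi_{i(a)}>\pi_{i(b)}$ iff $\rho_a>\rho_b$; otherwise $\pi$ avoids $\rho$. For a set $P$ of patterns, $\mathrm{av}(S;P)$ is the number of multipermutations of $S$ that avoid every pattern in $P$. Two sets of patterns $P,Q$ are $m$-equivalent, written here $P\sim Q$, if $\mathrm{av}(S;P)=\mathrm{av}(S;Q)$ for every multiset $S$. -}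

module Defs where

open import Data.Bool using (true; false)
open import Data.Fin as Fin using (Fin; zero; suc; toℕ)
import Data.Fin.Properties as Fin
open import Data.List using
  (List; []; _∷_; length; lookup; filter; applyUpTo; cartesianProductWith)
open import Data.List.Properties using (∷-injective)
open import Data.List.Membership.Propositional using (_∈_)
open import Data.List.Membership.Propositional.Properties using
  (∈-cartesianProductWith⁺; ∈-applyUpTo⁺; ∈-filter⁺; ∈-filter⁻)
open import Data.List.Relation.Unary.All as All using (All; []; _∷_)
open import Data.List.Relation.Unary.Any using (here)
open import Data.List.Relation.Unary.Unique.Propositional using (Unique; []; _∷_)
import Data.List.Relation.Unary.Unique.Propositional.Properties as Unique
open import Data.Nat using (ℕ; zero; suc; _+_; _≡ᵇ_; _≤_; _<_; _>_; s≤s)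
open import Data.Nat.Properties using
  ( _≟_; _<?_; _≤?_; _>?_; +-0-commutativeMonoid; <⇒≢ )
open import Data.Product using (∃; _×_; _,_; proj₂)
import Data.Vec.Functional as Vector
open import Function using (_∘_; _⇔_; mk⇔; Equivalence)
open import Relation.Binary.PropositionalEquality using
  (_≡_; _≗_; refl; sym; trans; cong; cong₂; subst)
open import Relation.Nullary using (Dec; ¬_; ¬?)
open import Relation.Nullary.Decidable using (map′; _×-dec_; _→-dec_)
open import Relation.Unary using (Decidable)

open import Algebra.Properties.CommutativeMonoid.Sum +-0-commutativeMonoid using
  (sum; ∑-distrib-+; sum-replicate-zero; sum-cong-≗)

Word : Set
Word = List ℕ

occurrences : ℕ → Word → ℕ
occurrences x w = length (filter (x ≟_) w)

-- The multiset 1^{a₁} 2^{a₂} ⋯ k^{a_k}.  An index i : Fin k stands for the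
-- letter suc (toℕ i) ∈ {1, …, k}.
record Multiset : Set where
  field
    k   : ℕ
    k≥1 : 1 ≤ k
    a   : Fin k → ℕ
    a≥1 : ∀ i → 1 ≤ a i

  size : ℕ
  size = sum a

IsMultipermutation : Multiset → Word → Set
IsMultipermutation S w =
  (∀ i → occurrences (suc (toℕ i)) w ≡ a i) × All (λ x → 1 ≤ x × x ≤ k) w
  where open Multiset S

infix 4 _contains_ _contains?_

_contains_ : Word → Word → Set
π contains ρ = ∃ λ (i : Fin (length ρ) → Fin (length π)) →
  (∀ a b → a Fin.< b → i a Fin.< i b) ×
  (∀ a b →
    (lookup π (i a) < lookup π (i b) ⇔ lookup ρ a < lookup ρ b) ×
    (lookup π (i a) > lookup π (i b) ⇔ lookup ρ a > lookup ρ b))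

AvoidsAll : List Word → Word → Set
AvoidsAll P π = All (λ ρ → ¬ (π contains ρ)) P

private
  ⇔-dec : {A B : Set} → Dec A → Dec B → Dec (A ⇔ B)
  ⇔-dec A? B? = map′ (λ (f , g) → mk⇔ f g)
                     (λ e → Equivalence.to e , Equivalence.from e)
                     ((A? →-dec B?) ×-dec (B? →-dec A?))

  cons-head-tail : ∀ {m} {A : Set} (f : Fin (suc m) → A) →
                   f ≗ Vector._∷_ (f zero) (f ∘ suc)
  cons-head-tail f zero    = refl
  cons-head-tail f (suc _) = refl

  -- Without function extensionality, an exhaustive search over Fin m → Fin n
  -- needs P to respect pointwise equality.
  anyFunction? : ∀ m {n} {P : (Fin m → Fin n) → Set} →
                 (∀ {f g} → f ≗ g → P f → P g) → Decidable P → Dec (∃ P)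
  anyFunction? zero    resp P? =
    map′ (λ p → Vector.[] , p) (λ (_ , p) → resp (λ ()) p) (P? Vector.[])
  anyFunction? (suc m) resp P? =
    map′ (λ (x , f , p) → Vector._∷_ x f , p)
         (λ (f , p) → f zero , f ∘ suc , resp (cons-head-tail f) p)
         (Fin.any? λ x → anyFunction? m
           (λ f≗g → resp λ { zero → refl ; (suc j) → f≗g j })
           (P? ∘ Vector._∷_ x))

_contains?_ : ∀ π ρ → Dec (π contains ρ)
π contains? ρ = anyFunction? (length ρ)
  (λ {f} {g} f≗g (mono , iso) →
    (λ a b a<b → subst (Fin._< g b) (f≗g a)
                   (subst (f a Fin.<_) (f≗g b) (mono a b a<b))) ,
    (λ a b →
      subst (λ x → Same x (g b) a b) (f≗g a)
        (subst (λ y → Same (f a) y a b) (f≗g b) (iso a b))))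
  (λ i →
    Fin.all? (λ a → Fin.all? λ b → (a Fin.<? b) →-dec (i a Fin.<? i b)) ×-dec
    Fin.all? (λ a → Fin.all? λ b →
      ⇔-dec (lookup π (i a) <? lookup π (i b)) (lookup ρ a <? lookup ρ b) ×-dec
      ⇔-dec (lookup π (i a) >? lookup π (i b)) (lookup ρ a >? lookup ρ b)))
  where
  Same : Fin (length π) → Fin (length π) → Fin (length ρ) → Fin (length ρ) → Set
  Same x y a b =
    (lookup π x < lookup π y ⇔ lookup ρ a < lookup ρ b) ×
    (lookup π x > lookup π y ⇔ lookup ρ a > lookup ρ b)

avoidsAll? : ∀ P → Decidable (AvoidsAll P)
avoidsAll? P π = All.all? (λ ρ → ¬? (π contains? ρ)) P

isMultipermutation? : ∀ S → Decidable (IsMultipermutation S)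
isMultipermutation? S w =
  Fin.all? (λ i → occurrences (suc (toℕ i)) w ≟ a i) ×-dec
  All.all? (λ x → (1 ≤? x) ×-dec (x ≤? k)) w
  where open Multiset S

words : (k n : ℕ) → List Word
words k zero    = [] ∷ []
words k (suc n) = cartesianProductWith _∷_ (applyUpTo suc k) (words k n)

-- See ∈-multipermutations and multipermutations-unique for the fact that this
-- lists each multipermutation of S exactly once.
multipermutations : Multiset → List Word
multipermutations S = filter (isMultipermutation? S) (words k size)
  where open Multiset S

av : Multiset → List Word → ℕ
av S P = length (filter (avoidsAll? P) (multipermutations S))

-- Finite sets of patterns are represented by lists; av depends only on which
-- words occur in the list.
infix 4 _∼_

_∼_ : List Word → List Word → Set
P ∼ Q = ∀ S → av S P ≡ av S Q

private
  indicator : ℕ → ℕ → ℕ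
  indicator x y = occurrences x (y ∷ [])

  occurrences-∷ : ∀ x y w → occurrences x (y ∷ w) ≡ indicator x y + occurrences x w
  occurrences-∷ x y w with x ≡ᵇ y
  ... | true  = refl
  ... | false = refl

  indicator-suc : ∀ x y → indicator (suc x) (suc y) ≡ indicator x y
  indicator-suc x y with x ≡ᵇ y
  ... | true  = refl
  ... | false = refl

  sum-indicator : ∀ k y → y < k → sum {k} (λ i → indicator (toℕ i) y) ≡ 1
  sum-indicator (suc k) zero    _         = cong suc (sum-replicate-zero k)
  sum-indicator (suc k) (suc y) (s≤s y<k) =
    trans (sum-cong-≗ {k} (λ i → indicator-suc (toℕ i) y)) (sum-indicator k y y<k)

  length≡sum : ∀ k w → All (λ x → 1 ≤ x × x ≤ k) w →
               sum {k} (λ i → occurrences (suc (toℕ i)) w) ≡ length w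
  length≡sum k []          []              = sum-replicate-zero k
  length≡sum k (suc y ∷ w) ((_ , y<k) ∷ ok) =
    trans (sum-cong-≗ {k} (λ i → trans (occurrences-∷ (suc (toℕ i)) (suc y) w)
                                  (cong (_+ _) (indicator-suc (toℕ i) y))))
    (trans (∑-distrib-+ {k} _ _)
           (cong₂ _+_ (sum-indicator k y y<k) (length≡sum k w ok)))

  ∈-words : ∀ k w → All (λ x → 1 ≤ x × x ≤ k) w → w ∈ words k (length w)
  ∈-words k []          []               = here refl
  ∈-words k (suc y ∷ w) ((_ , y<k) ∷ ok) =
    ∈-cartesianProductWith⁺ _∷_ (∈-applyUpTo⁺ suc y<k) (∈-words k w ok)

  words-unique : ∀ k n → Unique (words k n)
  words-unique k zero    = [] ∷ []
  words-unique k (suc n) = Unique.cartesianProductWith⁺ _∷_ ∷-injective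
    (Unique.applyUpTo⁺₁ suc k (λ i<j _ → <⇒≢ (s≤s i<j))) (words-unique k n)

∈-multipermutations : ∀ S w → w ∈ multipermutations S ⇔ IsMultipermutation S w
∈-multipermutations S w = mk⇔
  (λ w∈ → proj₂ (∈-filter⁻ (isMultipermutation? S) {xs = words k size} w∈))
  (λ (occ , ok) → ∈-filter⁺ (isMultipermutation? S)
    (subst (λ n → w ∈ words k n)
      (trans (sym (length≡sum k w ok)) (sum-cong-≗ {k} occ))
      (∈-words k w ok))
    (occ , ok))
  where open Multiset S

multipermutations-unique : ∀ S → Unique (multipermutations S)
multipermutations-unique S =
  Unique.filter⁺ (isMultipermutation? S) (words-unique k size)
  where open Multiset S

{-# OPTIONS --safe #-}

-- Reversing the words that avoid {132, 2213}, and complementing the letters of those that avoid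
-- {213, 1322}, turns both classes into the words that avoid {231, 3122}; complementation reverses
-- the multiplicities.  So the number of words avoiding {231, 3122} with multiplicities a₁, …, aₖ
-- must be shown to be invariant under reversing (a₁, …, aₖ).
--
-- Such a word is built by inserting the letters k, k − 1, …, 1 in turn.  A copy of a new least
-- letter x must not follow an ascent, nor precede two equal letters smaller than some letter in
-- front of it.  Apart from the front of the word, where x is always allowed, let t be the number
-- of places where x may be inserted.  The values of t after the insertion of a copies of x depend
-- only on a and t, so the count is the number of paths of a transfer operator Tₐ on ℕ that start
-- at 0.  With respect to the pairing ⟨s, t⟩ = C(s + t, s) each Tₐ is self-adjoint: ⟨s, Tₐ t⟩ is
-- C(s + t + 2, s + 1) − 1 for a = 1 and C(s + t + a, a) + s t (s + t + 2) / 2 for a ≥ 2.  Since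
-- ⟨0, t⟩ = 1, the number of paths from 0 does not change when the sequence of the a's is reversed.
module Submission where

open import Defs
open import Data.Bool using (if_then_else_)
open import Data.Fin as Fin using (Fin; zero; suc; toℕ; opposite; fromℕ; inject₁)
import Data.Fin.Properties as Fin
open import Data.Fin.Patterns using (0F; 1F; 2F; 3F)
open import Data.List using
  ( List; []; _∷_; [_]; _++_; map; filter; concat; concatMap; replicate; reverse; length
  ; lookup; tabulate )
open import Data.List.Membership.DecPropositional using (_∈?_)
open import Data.List.Membership.Propositional using (_∈_; find; lose)
open import Data.List.Membership.Propositional.Properties using
  ( ∈-map⁺; ∈-map⁻; ∈-++⁺ˡ; ∈-++⁺ʳ; ∈-++⁻; ∈-concatMap⁺; ∈-concatMap⁻; ∈-filter⁺; ∈-filter⁻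
  ; ∈-lookup )
open import Data.List.Membership.Propositional.Properties.WithK using (unique∧set⇒bag)
open import Data.List.Properties using
  ( map-++; map-∘; map-id; map-cong; map-cong-local; map-concatMap; concatMap-map; length-map
  ; length-++; length-replicate; filter-accept; filter-reject; filter-some; unfold-reverse
  ; reverse-++; reverse-involutive; ∷-injectiveˡ; ∷-injectiveʳ )
open import Data.List.Relation.Binary.BagAndSetEquality using (∼bag⇒↭)
open import Data.List.Relation.Binary.Disjoint.Propositional using (Disjoint)
open import Data.List.Relation.Binary.Permutation.Propositional using (_↭_; ↭-sym)
open import Data.List.Relation.Binary.Permutation.Propositional.Properties using
  ( ↭-length; ↭-reverse; filter-↭; All-resp-↭ )
open import Data.List.Relation.Binary.Sublist.Propositional using
  ( _⊆_; []; _∷_; _∷ʳ_; ⊆-trans; ⊆-refl; from∈; to∈; minimum )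
open import Data.List.Relation.Binary.Sublist.Propositional.Properties using
  ( All-resp-⊆; filter-⊆; map⁺; reverse⁺; ∷ˡ⁻ )
open import Data.List.Relation.Unary.All as All using (All; []; _∷_)
import Data.List.Relation.Unary.All.Properties as All
open import Data.List.Relation.Unary.AllPairs using ([]; _∷_)
open import Data.List.Relation.Unary.Any using (here; there)
open import Data.List.Relation.Unary.Unique.Propositional using (Unique)
import Data.List.Relation.Unary.Unique.Propositional.Properties as Unique
open import Data.Nat using (ℕ; zero; suc; _+_; _*_; _∸_; _≤_; _<_; z≤n; s≤s)
open import Data.Nat.ListAction using (sum)
open import Data.Nat.ListAction.Properties using (sum-++)
open import Data.Nat.Properties
open import Data.Nat.Tactic.RingSolver using (solve-∀)
open import Data.Product using (∃; _×_; _,_; proj₁; proj₂)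
open import Data.Sum using (_⊎_; inj₁; inj₂)
open import Function using (_∘_; _⇔_; mk⇔; Equivalence)
open import Relation.Binary.Definitions using (tri<; tri≈; tri>)
open import Relation.Binary.PropositionalEquality hiding ([_])
open import Relation.Nullary using (Dec; yes; no; does; ¬_; ¬?; contradiction)
open import Relation.Nullary.Decidable using (map′; _×-dec_; _⊎-dec_; dec-true; dec-false)

-- Finite sums over lists

Σ[_] : {A : Set} → (A → ℕ) → List A → ℕ
Σ[ h ] xs = sum (map h xs)

Σ-++ : ∀ {A : Set} (h : A → ℕ) xs ys → Σ[ h ] (xs ++ ys) ≡ Σ[ h ] xs + Σ[ h ] ys
Σ-++ h xs ys = trans (cong sum (map-++ h xs ys)) (sum-++ (map h xs) (map h ys))

Σ-cong : ∀ {A : Set} {g h : A → ℕ} → g ≗ h → ∀ xs → Σ[ g ] xs ≡ Σ[ h ] xs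
Σ-cong g≗h xs = cong sum (map-cong g≗h xs)

Σ-map : ∀ {A B : Set} (h : B → ℕ) (f : A → B) xs → Σ[ h ] (map f xs) ≡ Σ[ h ∘ f ] xs
Σ-map h f xs = cong sum (sym (map-∘ xs))

Σ-replicate : ∀ {A : Set} (h : A → ℕ) n x → Σ[ h ] (replicate n x) ≡ n * h x
Σ-replicate h zero    x = refl
Σ-replicate h (suc n) x = cong (h x +_) (Σ-replicate h n x)

Σ-concatMap : ∀ {A B : Set} (h : B → ℕ) (f : A → List B) xs →
              Σ[ h ] (concatMap f xs) ≡ Σ[ Σ[ h ] ∘ f ] xs
Σ-concatMap h f []       = refl
Σ-concatMap h f (x ∷ xs) =
  trans (Σ-++ h (f x) (concatMap f xs)) (cong (Σ[ h ] (f x) +_) (Σ-concatMap h f xs))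

Σ-0 : ∀ {A : Set} (xs : List A) → Σ[ (λ _ → 0) ] xs ≡ 0
Σ-0 []       = refl
Σ-0 (_ ∷ xs) = Σ-0 xs

Σ-1 : ∀ {A : Set} (xs : List A) → Σ[ (λ _ → 1) ] xs ≡ length xs
Σ-1 []       = refl
Σ-1 (_ ∷ xs) = cong suc (Σ-1 xs)

Σ-+ : ∀ {A : Set} (g h : A → ℕ) xs → Σ[ (λ x → g x + h x) ] xs ≡ Σ[ g ] xs + Σ[ h ] xs
Σ-+ g h []       = refl
Σ-+ g h (x ∷ xs) = trans (cong (g x + h x +_) (Σ-+ g h xs)) (interchange (g x) (h x) _ _)
  where
  interchange : ∀ a b c d → (a + b) + (c + d) ≡ (a + c) + (b + d)
  interchange = solve-∀

Σ-swap : ∀ {A B : Set} (h : A → B → ℕ) xs ys →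
         Σ[ (λ x → Σ[ h x ] ys) ] xs ≡ Σ[ (λ y → Σ[ (λ x → h x y) ] xs) ] ys
Σ-swap h []       ys = sym (Σ-0 ys)
Σ-swap h (x ∷ xs) ys = trans (cong (Σ[ h x ] ys +_) (Σ-swap h xs ys)) (sym (Σ-+ (h x) _ ys))

-- Transfer operators

-- The number of multisets of size `a` drawn from `t` places; the recursion asks whether the first
-- place is drawn.
multichoose : ℕ → ℕ → ℕ
multichoose zero    t       = 1
multichoose (suc a) zero    = 0
multichoose (suc a) (suc t) = multichoose a (suc t) + multichoose (suc a) t

-- With t inner places (those not at the front) open to a new least letter, next a t lists the
-- numbers of inner places open to the following letter after a copies have been inserted:
-- innerFrom collects the cases in which no copy is at the front, leadingFrom those in which one
-- is and a more follow anywhere.  In clusterFrom one copy has been put in the first admissible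
-- inner place, and a more go there or into the t inner places to its right.
leadingFrom : ℕ → ℕ → List ℕ
leadingFrom zero    t = [ 1 ]
leadingFrom (suc a) t = map suc (leadingFrom a t) ++ replicate (multichoose (suc a) t) 1

clusterFrom : ℕ → ℕ → List ℕ
clusterFrom zero          t = [ 1 ]
clusterFrom (suc zero)    t = 2 ∷ replicate (multichoose 1 t) 1
clusterFrom (suc (suc a)) t = clusterFrom (suc a) t ++ replicate (multichoose (2 + a) t) 0

innerFrom : ℕ → ℕ → List ℕ
innerFrom zero          t       = [ t ]
innerFrom (suc a)       zero    = []
innerFrom (suc zero)    (suc t) = 2 ∷ map suc (innerFrom 1 t)
innerFrom (suc (suc a)) (suc t) = clusterFrom (suc a) t ++ innerFrom (2 + a) t

next : ℕ → ℕ → List ℕ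
next zero    t = [ t ]
next (suc a) t = leadingFrom a t ++ innerFrom (suc a) t

-- The endpoints, with repetition, of the paths from `s`. The head of the list is the last step,
-- just as the least letter is inserted last.
walk : List ℕ → ℕ → List ℕ
walk []       s = [ s ]
walk (a ∷ as) s = concatMap (next a) (walk as s)

-- The binomial pairing and self-adjointness

pairing : ℕ → ℕ → ℕ
pairing s t = multichoose s (suc t)

pairing-zeroʳ : ∀ s → pairing s 0 ≡ 1
pairing-zeroʳ zero    = refl
pairing-zeroʳ (suc s) = trans (+-identityʳ _) (pairing-zeroʳ s)

-- The recursion of `pairing` is Pascal's rule for C(s + t, s), which treats both arguments alike.
pairing-comm : ∀ s t → pairing s t ≡ pairing t s
pairing-comm zero    t       = sym (pairing-zeroʳ t)
pairing-comm (suc s) zero    = pairing-zeroʳ (suc s)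
pairing-comm (suc s) (suc t) = trans (+-comm (pairing s (suc t)) (pairing (suc s) t))
  (cong₂ _+_ (pairing-comm (suc s) t) (pairing-comm s (suc t)))

pairing-oneˡ : ∀ t → pairing 1 t ≡ suc t
pairing-oneˡ zero    = refl
pairing-oneˡ (suc t) = cong suc (pairing-oneˡ t)

pairing-oneʳ : ∀ s → pairing s 1 ≡ suc s
pairing-oneʳ s = trans (pairing-comm s 1) (pairing-oneˡ s)

multichoose-one : ∀ t → multichoose 1 t ≡ t
multichoose-one zero    = refl
multichoose-one (suc t) = cong suc (multichoose-one t)

-- When `suc a` copies are distributed over the front and `t` inner places, `multichoose (suc a) t`
-- distributions leave the front empty; `leadingFrom a t` lists the others.
length-leadingFrom : ∀ a t → length (leadingFrom a t) + multichoose (suc a) t ≡ pairing (suc a) t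
length-leadingFrom zero    t = refl
length-leadingFrom (suc a) t = cong (_+ multichoose (2 + a) t) (begin
  length (map suc (leadingFrom a t) ++ replicate (multichoose (suc a) t) 1)
    ≡⟨ length-++ (map suc (leadingFrom a t)) ⟩
  length (map suc (leadingFrom a t)) + length (replicate (multichoose (suc a) t) 1)
    ≡⟨ cong₂ _+_ (length-map suc (leadingFrom a t)) (length-replicate _) ⟩
  length (leadingFrom a t) + multichoose (suc a) t
    ≡⟨ length-leadingFrom a t ⟩
  pairing (suc a) t ∎)
  where open ≡-Reasoning

Σ-leadingFrom-suc : ∀ h a t →
  Σ[ h ] (leadingFrom (suc a) t) ≡ Σ[ h ∘ suc ] (leadingFrom a t) + multichoose (suc a) t * h 1
Σ-leadingFrom-suc h a t = trans
  (Σ-++ h (map suc (leadingFrom a t)) _)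
  (cong₂ _+_ (Σ-map h suc (leadingFrom a t)) (Σ-replicate h (multichoose (suc a) t) 1))

-- Vandermonde's convolution for multisets.
Σ-pairing-leadingFrom : ∀ s a t →
  Σ[ pairing s ] (leadingFrom a t) + multichoose (suc a) t ≡ pairing (suc a) (s + t)
Σ-pairing-leadingFrom zero a t =
  trans (cong (_+ multichoose (suc a) t) (Σ-1 (leadingFrom a t))) (length-leadingFrom a t)
Σ-pairing-leadingFrom (suc s) zero t = begin
  pairing (suc s) 1 + 0 + multichoose 1 t
    ≡⟨ cong₂ _+_ (trans (+-identityʳ _) (pairing-oneʳ (suc s))) (multichoose-one t) ⟩
  suc (suc s) + t
    ≡⟨ pairing-oneˡ (suc s + t) ⟨
  pairing 1 (suc s + t) ∎
  where open ≡-Reasoning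
Σ-pairing-leadingFrom (suc s) (suc a) t = begin
  Σ[ pairing (suc s) ] (leadingFrom (suc a) t) + m₂
    ≡⟨ cong (_+ m₂) (Σ-leadingFrom-suc (pairing (suc s)) a t) ⟩
  Σ[ (λ c → pairing s (suc c) + pairing (suc s) c) ] (leadingFrom a t) + m₁ * (pairing s 1 + pairing (suc s) 0) + m₂
    ≡⟨ cong₂ (λ u v → u + m₁ * (pairing s 1 + v) + m₂)
         (Σ-+ (pairing s ∘ suc) (pairing (suc s)) (leadingFrom a t)) (pairing-zeroʳ (suc s)) ⟩
  Σ[ pairing s ∘ suc ] (leadingFrom a t) + Σ[ pairing (suc s) ] (leadingFrom a t)
    + m₁ * (pairing s 1 + 1) + m₂
    ≡⟨ rearrange (Σ[ pairing s ∘ suc ] (leadingFrom a t)) _ m₁ (pairing s 1) m₂ ⟩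
  (Σ[ pairing (suc s) ] (leadingFrom a t) + m₁)
    + ((Σ[ pairing s ∘ suc ] (leadingFrom a t) + m₁ * pairing s 1) + m₂)
    ≡⟨ cong₂ _+_ (Σ-pairing-leadingFrom (suc s) a t)
         (trans (cong (_+ m₂) (sym (Σ-leadingFrom-suc (pairing s) a t))) (Σ-pairing-leadingFrom s (suc a) t)) ⟩
  pairing (suc a) (suc s + t) + pairing (2 + a) (s + t) ∎
  where
  open ≡-Reasoning
  m₁ = multichoose (suc a) t
  m₂ = multichoose (2 + a) t
  rearrange : ∀ u v m p n → u + v + m * (p + 1) + n ≡ (v + m) + ((u + m * p) + n)
  rearrange = solve-∀

-- C(s+2, 2) − 1
excess : ℕ → ℕ
excess zero    = 0
excess (suc s) = excess s + (2 + s)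

-- The binomial coefficient C(t, 2).
triangle : ℕ → ℕ
triangle zero    = 0
triangle (suc t) = triangle t + t

pairing-twoʳ : ∀ s → pairing s 2 ≡ suc (excess s)
pairing-twoʳ zero    = refl
pairing-twoʳ (suc s) = cong₂ _+_ (pairing-twoʳ s) (pairing-oneʳ (suc s))

-- The list has one 2, `t` ones and otherwise zeros, of weights C(s + 2, 2), s + 1 and 1. The last
-- summand counts each entry once; the others collect what the 2 and the ones weigh beyond that.
Σ-pairing-clusterFrom : ∀ s a t →
  Σ[ pairing s ] (clusterFrom (suc a) t) ≡ excess s + t * s + pairing (suc a) t
Σ-pairing-clusterFrom s zero t = begin
  pairing s 2 + Σ[ pairing s ] (replicate (multichoose 1 t) 1)
    ≡⟨ cong₂ _+_ (pairing-twoʳ s) (trans (Σ-replicate (pairing s) (multichoose 1 t) 1)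
         (cong₂ _*_ (multichoose-one t) (pairing-oneʳ s))) ⟩
  suc (excess s) + t * suc s
    ≡⟨ rearrange (excess s) s t ⟩
  excess s + t * s + suc t
    ≡⟨ cong (excess s + t * s +_) (pairing-oneˡ t) ⟨
  excess s + t * s + pairing 1 t ∎
  where
  open ≡-Reasoning
  rearrange : ∀ e s t → suc e + t * suc s ≡ e + t * s + suc t
  rearrange = solve-∀
Σ-pairing-clusterFrom s (suc a) t = begin
  Σ[ pairing s ] (clusterFrom (2 + a) t)
    ≡⟨ Σ-++ (pairing s) (clusterFrom (suc a) t) _ ⟩
  Σ[ pairing s ] (clusterFrom (suc a) t) + Σ[ pairing s ] (replicate (multichoose (2 + a) t) 0)
    ≡⟨ cong₂ _+_ (Σ-pairing-clusterFrom s a t)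
         (trans (Σ-replicate (pairing s) (multichoose (2 + a) t) 0)
           (trans (cong (multichoose (2 + a) t *_) (pairing-zeroʳ s)) (*-identityʳ _))) ⟩
  excess s + t * s + pairing (suc a) t + multichoose (2 + a) t
    ≡⟨ +-assoc (excess s + t * s) _ _ ⟩
  excess s + t * s + pairing (2 + a) t ∎
  where open ≡-Reasoning

-- Sum over the first inner place that receives a copy. Each of the `t` choices contributes
-- `excess s`, and the numbers 0, ..., t - 1 of places to its right add up to `triangle t`.
Σ-pairing-innerFrom : ∀ s a t →
  Σ[ pairing s ] (innerFrom (2 + a) t) ≡ t * excess s + s * triangle t + multichoose (2 + a) t
Σ-pairing-innerFrom s a zero    = sym (trans (+-identityʳ (s * 0)) (*-zeroʳ s))
Σ-pairing-innerFrom s a (suc t) = begin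
  Σ[ pairing s ] (innerFrom (2 + a) (suc t))
    ≡⟨ Σ-++ (pairing s) (clusterFrom (suc a) t) _ ⟩
  Σ[ pairing s ] (clusterFrom (suc a) t) + Σ[ pairing s ] (innerFrom (2 + a) t)
    ≡⟨ cong₂ _+_ (Σ-pairing-clusterFrom s a t) (Σ-pairing-innerFrom s a t) ⟩
  (excess s + t * s + pairing (suc a) t) + (t * excess s + s * triangle t + multichoose (2 + a) t)
    ≡⟨ rearrange (excess s) s t (triangle t) _ _ ⟩
  suc t * excess s + s * triangle (suc t) + multichoose (2 + a) (suc t) ∎
  where
  open ≡-Reasoning
  rearrange : ∀ e s t r p m → (e + t * s + p) + (t * e + s * r + m) ≡ (e + t * e) + s * (r + t) + (p + m)
  rearrange = solve-∀

excess-double : ∀ s → 2 * excess s ≡ s * s + 3 * s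
excess-double zero    = refl
excess-double (suc s) = begin
  2 * (excess s + (2 + s))      ≡⟨ *-distribˡ-+ 2 (excess s) (2 + s) ⟩
  2 * excess s + 2 * (2 + s)    ≡⟨ cong (_+ 2 * (2 + s)) (excess-double s) ⟩
  s * s + 3 * s + 2 * (2 + s)   ≡⟨ expand s ⟩
  suc s * suc s + 3 * suc s     ∎
  where
  open ≡-Reasoning
  expand : ∀ s → s * s + 3 * s + 2 * (2 + s) ≡ suc s * suc s + 3 * suc s
  expand = solve-∀

-- Doubled, and with `t` on the left, so that neither division nor subtraction occurs.
triangle-double : ∀ t → 2 * triangle t + t ≡ t * t
triangle-double zero    = refl
triangle-double (suc t) = begin
  2 * (triangle t + t) + suc t     ≡⟨ regroup (triangle t) t ⟩
  2 * triangle t + t + (t + suc t) ≡⟨ cong (_+ (t + suc t)) (triangle-double t) ⟩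
  t * t + (t + suc t)              ≡⟨ expand t ⟩
  suc t * suc t                    ∎
  where
  open ≡-Reasoning
  regroup : ∀ r t → 2 * (r + t) + suc t ≡ 2 * r + t + (t + suc t)
  regroup = solve-∀
  expand : ∀ t → t * t + (t + suc t) ≡ suc t * suc t
  expand = solve-∀

correction-double : ∀ s t → 2 * (t * excess s + s * triangle t) ≡ s * t * (s + t + 2)
-- Adding `s * t` completes `2 * triangle t` to `2 * triangle t + t`, which is a square.
correction-double s t = +-cancelʳ-≡ (s * t) _ _ (begin
  2 * (t * excess s + s * triangle t) + s * t        ≡⟨ regroup s t (excess s) (triangle t) ⟩
  t * (2 * excess s) + s * (2 * triangle t + t)      ≡⟨ cong₂ (λ u v → t * u + s * v) (excess-double s) (triangle-double t) ⟩
  t * (s * s + 3 * s) + s * (t * t)                  ≡⟨ expand s t ⟩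
  s * t * (s + t + 2) + s * t                        ∎)
  where
  open ≡-Reasoning
  regroup : ∀ s t e r → 2 * (t * e + s * r) + s * t ≡ t * (2 * e) + s * (2 * r + t)
  regroup = solve-∀
  expand : ∀ s t → t * (s * s + 3 * s) + s * (t * t) ≡ s * t * (s + t + 2) + s * t
  expand = solve-∀

correction-comm : ∀ s t → t * excess s + s * triangle t ≡ s * excess t + t * triangle s
correction-comm s t = *-cancelˡ-≡ _ _ 2 (begin
  2 * (t * excess s + s * triangle t) ≡⟨ correction-double s t ⟩
  s * t * (s + t + 2)                 ≡⟨ swap s t ⟩
  t * s * (t + s + 2)                 ≡⟨ correction-double t s ⟨
  2 * (s * excess t + t * triangle s) ∎)
  where
  open ≡-Reasoning
  swap : ∀ s t → s * t * (s + t + 2) ≡ t * s * (t + s + 2)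
  swap = solve-∀

-- The list `innerFrom 1 t` is 2, 3, ..., t + 1. Its definition extends it at the front; the
-- hockey-stick summation needs the extension at the end.
Σ-innerFrom-one-suc : ∀ h t → Σ[ h ] (innerFrom 1 (suc t)) ≡ Σ[ h ] (innerFrom 1 t) + h (2 + t)
Σ-innerFrom-one-suc h zero    = +-identityʳ (h 2)
Σ-innerFrom-one-suc h (suc t) = begin
  h 2 + Σ[ h ] (map suc (innerFrom 1 (suc t)))
    ≡⟨ cong (h 2 +_) (Σ-map h suc (innerFrom 1 (suc t))) ⟩
  h 2 + Σ[ h ∘ suc ] (innerFrom 1 (suc t))
    ≡⟨ cong (h 2 +_) (Σ-innerFrom-one-suc (h ∘ suc) t) ⟩
  h 2 + (Σ[ h ∘ suc ] (innerFrom 1 t) + h (3 + t))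
    ≡⟨ +-assoc (h 2) _ _ ⟨
  h 2 + Σ[ h ∘ suc ] (innerFrom 1 t) + h (3 + t)
    ≡⟨ cong (λ n → h 2 + n + h (3 + t)) (Σ-map h suc (innerFrom 1 t)) ⟨
  h 2 + Σ[ h ] (map suc (innerFrom 1 t)) + h (3 + t) ∎
  where open ≡-Reasoning

-- Hockey-stick identity.
Σ-pairing-next-one : ∀ s t → suc (Σ[ pairing s ] (next 1 t)) ≡ pairing (suc s) (suc t)
Σ-pairing-next-one s zero    = begin
  suc (pairing s 1 + 0)         ≡⟨ cong suc (+-identityʳ _) ⟩
  suc (pairing s 1)             ≡⟨ cong suc (pairing-oneʳ s) ⟩
  suc (suc s)                   ≡⟨ pairing-oneʳ (suc s) ⟨
  pairing (suc s) 1             ∎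
  where open ≡-Reasoning
Σ-pairing-next-one s (suc t) = begin
  suc (pairing s 1 + Σ[ pairing s ] (innerFrom 1 (suc t)))
    ≡⟨ cong (λ n → suc (pairing s 1 + n)) (Σ-innerFrom-one-suc (pairing s) t) ⟩
  suc (pairing s 1 + (Σ[ pairing s ] (innerFrom 1 t) + pairing s (2 + t)))
    ≡⟨ cong suc (+-assoc (pairing s 1) _ _) ⟨
  suc (Σ[ pairing s ] (next 1 t)) + pairing s (2 + t)
    ≡⟨ cong (_+ pairing s (2 + t)) (Σ-pairing-next-one s t) ⟩
  pairing (suc s) (suc t) + pairing s (2 + t)
    ≡⟨ +-comm (pairing (suc s) (suc t)) _ ⟩
  pairing (suc s) (2 + t) ∎
  where open ≡-Reasoning

Σ-pairing-next : ∀ s a t → Σ[ pairing s ] (next (2 + a) t) ≡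
                 pairing (2 + a) (s + t) + (t * excess s + s * triangle t)
Σ-pairing-next s a t = begin
  Σ[ pairing s ] (next (2 + a) t)
    ≡⟨ Σ-++ (pairing s) (leadingFrom (suc a) t) _ ⟩
  Σ[ pairing s ] (leadingFrom (suc a) t) + Σ[ pairing s ] (innerFrom (2 + a) t)
    ≡⟨ cong (Σ[ pairing s ] (leadingFrom (suc a) t) +_) (Σ-pairing-innerFrom s a t) ⟩
  Σ[ pairing s ] (leadingFrom (suc a) t) + (t * excess s + s * triangle t + multichoose (2 + a) t)
    ≡⟨ regroup (Σ[ pairing s ] (leadingFrom (suc a) t)) (t * excess s + s * triangle t) _ ⟩
  Σ[ pairing s ] (leadingFrom (suc a) t) + multichoose (2 + a) t + (t * excess s + s * triangle t)
    ≡⟨ cong (_+ (t * excess s + s * triangle t)) (Σ-pairing-leadingFrom s (suc a) t) ⟩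
  pairing (2 + a) (s + t) + (t * excess s + s * triangle t) ∎
  where
  open ≡-Reasoning
  regroup : ∀ u v w → u + (v + w) ≡ u + w + v
  regroup = solve-∀

next-selfAdjoint : ∀ a s t → Σ[ pairing s ] (next a t) ≡ Σ[ pairing t ] (next a s)
next-selfAdjoint zero          s t = cong (_+ 0) (pairing-comm s t)
next-selfAdjoint (suc zero)    s t = suc-injective (begin
  suc (Σ[ pairing s ] (next 1 t)) ≡⟨ Σ-pairing-next-one s t ⟩
  pairing (suc s) (suc t)         ≡⟨ pairing-comm (suc s) (suc t) ⟩
  pairing (suc t) (suc s)         ≡⟨ Σ-pairing-next-one t s ⟨
  suc (Σ[ pairing t ] (next 1 s)) ∎)
  where open ≡-Reasoning
next-selfAdjoint (suc (suc a)) s t = begin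
  Σ[ pairing s ] (next (2 + a) t)
    ≡⟨ Σ-pairing-next s a t ⟩
  pairing (2 + a) (s + t) + (t * excess s + s * triangle t)
    ≡⟨ cong₂ (λ n c → pairing (2 + a) n + c) (+-comm s t) (correction-comm s t) ⟩
  pairing (2 + a) (t + s) + (s * excess t + t * triangle s)
    ≡⟨ Σ-pairing-next t a s ⟨
  Σ[ pairing t ] (next (2 + a) s) ∎
  where open ≡-Reasoning

-- Reversing a product of transfer operators

-- The matrix entry at `t` and `s` of the product of the operators in `as`, the rightmost acting
-- first.
walkPairing : List ℕ → ℕ → ℕ → ℕ
walkPairing as s t = Σ[ pairing t ] (walk as s)

-- The head acts last, so self-adjointness moves it to the other argument of the pairing, where it
-- acts on `t`.
walkPairing-∷ : ∀ a as s t → walkPairing (a ∷ as) s t ≡ Σ[ walkPairing as s ] (next a t)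
walkPairing-∷ a as s t = begin
  Σ[ pairing t ] (concatMap (next a) (walk as s))
    ≡⟨ Σ-concatMap (pairing t) (next a) (walk as s) ⟩
  Σ[ (λ u → Σ[ pairing t ] (next a u)) ] (walk as s)
    ≡⟨ Σ-cong (λ u → trans (next-selfAdjoint a t u) (Σ-cong (pairing-comm u) (next a t))) (walk as s) ⟩
  Σ[ (λ u → Σ[ (λ v → pairing v u) ] (next a t)) ] (walk as s)
    ≡⟨ Σ-swap (λ u v → pairing v u) (walk as s) (next a t) ⟩
  Σ[ walkPairing as s ] (next a t) ∎
  where open ≡-Reasoning

-- The last element acts first, on `s`. The induction peels off operators on the side of `t`, and
-- the two sums are interchanged.
walkPairing-∷ʳ : ∀ a as s t → walkPairing (as ++ [ a ]) s t ≡ Σ[ (λ u → walkPairing as u t) ] (next a s)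
walkPairing-∷ʳ a []       s t = begin
  walkPairing [ a ] s t                                ≡⟨ walkPairing-∷ a [] s t ⟩
  Σ[ walkPairing [] s ] (next a t)                     ≡⟨ Σ-cong (λ u → trans (+-identityʳ _) (pairing-comm u s)) (next a t) ⟩
  Σ[ pairing s ] (next a t)                            ≡⟨ next-selfAdjoint a s t ⟩
  Σ[ pairing t ] (next a s)                            ≡⟨ Σ-cong (λ _ → +-identityʳ _) (next a s) ⟨
  Σ[ (λ u → walkPairing [] u t) ] (next a s)           ∎
  where open ≡-Reasoning
walkPairing-∷ʳ a (b ∷ as) s t = begin
  walkPairing (b ∷ as ++ [ a ]) s t
    ≡⟨ walkPairing-∷ b (as ++ [ a ]) s t ⟩
  Σ[ walkPairing (as ++ [ a ]) s ] (next b t)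
    ≡⟨ Σ-cong (walkPairing-∷ʳ a as s) (next b t) ⟩
  Σ[ (λ v → Σ[ (λ u → walkPairing as u v) ] (next a s)) ] (next b t)
    ≡⟨ Σ-swap (λ v u → walkPairing as u v) (next b t) (next a s) ⟩
  Σ[ (λ u → Σ[ walkPairing as u ] (next b t)) ] (next a s)
    ≡⟨ Σ-cong (λ u → walkPairing-∷ b as u t) (next a s) ⟨
  Σ[ (λ u → walkPairing (b ∷ as) u t) ] (next a s) ∎
  where open ≡-Reasoning

-- The adjoint of a product of self-adjoint operators is the product in reverse order.
walkPairing-reverse : ∀ as s t → walkPairing (reverse as) s t ≡ walkPairing as t s
walkPairing-reverse []       s t = cong (_+ 0) (pairing-comm t s)
walkPairing-reverse (a ∷ as) s t = begin
  walkPairing (reverse (a ∷ as)) s t                  ≡⟨ cong (λ bs → walkPairing bs s t) (unfold-reverse a as) ⟩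
  walkPairing (reverse as ++ [ a ]) s t                   ≡⟨ walkPairing-∷ʳ a (reverse as) s t ⟩
  Σ[ (λ u → walkPairing (reverse as) u t) ] (next a s) ≡⟨ Σ-cong (λ u → walkPairing-reverse as u t) (next a s) ⟩
  Σ[ walkPairing as t ] (next a s)                    ≡⟨ walkPairing-∷ a as t s ⟨
  walkPairing (a ∷ as) t s                            ∎
  where open ≡-Reasoning

-- Since `pairing 0 t` is 1, pairing with 0 counts the paths.
length-walk-reverse : ∀ as → length (walk (reverse as) 0) ≡ length (walk as 0)
length-walk-reverse as = begin
  length (walk (reverse as) 0) ≡⟨ Σ-1 (walk (reverse as) 0) ⟨
  walkPairing (reverse as) 0 0 ≡⟨ walkPairing-reverse as 0 0 ⟩
  walkPairing as 0 0           ≡⟨ Σ-1 (walk as 0) ⟩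
  length (walk as 0)           ∎
  where open ≡-Reasoning

-- Inserting a new least letter

erase : ℕ → Word → Word
erase x = filter (λ y → ¬? (x ≟ y))

erase-here : ∀ x w → erase x (x ∷ w) ≡ erase x w
erase-here x w = filter-reject (λ y → ¬? (x ≟ y)) (λ x≢x → x≢x refl)

erase-there : ∀ {x y} w → x ≢ y → erase x (y ∷ w) ≡ y ∷ erase x w
erase-there w x≢y = filter-accept (λ y → ¬? (_ ≟ y)) x≢y

occurrences-here : ∀ x w → occurrences x (x ∷ w) ≡ suc (occurrences x w)
occurrences-here x w = cong length (filter-accept (x ≟_) {xs = w} refl)

occurrences-there : ∀ {x y} w → x ≢ y → occurrences x (y ∷ w) ≡ occurrences x w
occurrences-there {x} w x≢y = cong length (filter-reject (x ≟_) {xs = w} x≢y)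

erase-absent : ∀ {x r} → All (x <_) r → erase x r ≡ r
erase-absent []                       = refl
erase-absent {r = z ∷ r} (x<z ∷ x<r) = trans (erase-there r (<⇒≢ x<z)) (cong (z ∷_) (erase-absent x<r))

occurrences-absent : ∀ {x r} → All (x <_) r → occurrences x r ≡ 0
occurrences-absent []                       = refl
occurrences-absent {r = z ∷ r} (x<z ∷ x<r) = trans (occurrences-there r (<⇒≢ x<z)) (occurrences-absent x<r)

∈-occurrences : ∀ x g {n} → occurrences x g ≡ suc n → x ∈ g
∈-occurrences x []      ()
∈-occurrences x (z ∷ g) eq with x ≟ z
... | yes refl = here refl
... | no x≢z   = there (∈-occurrences x g (trans (sym (occurrences-there g x≢z)) eq))

⊆-erase : ∀ {x ρ g} → All (x ≢_) ρ → ρ ⊆ g → ρ ⊆ erase x g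
⊆-erase _ [] = []
⊆-erase {x} {g = z ∷ g} x≢ρ (.z ∷ʳ τ) with x ≟ z
... | yes refl = subst (_ ⊆_) (sym (erase-here x g)) (⊆-erase x≢ρ τ)
... | no  x≢z  = subst (_ ⊆_) (sym (erase-there g x≢z)) (z ∷ʳ ⊆-erase x≢ρ τ)
⊆-erase {g = z ∷ g} (x≢z ∷ x≢ρ) (refl ∷ τ) =
  subst (_ ⊆_) (sym (erase-there g x≢z)) (refl ∷ ⊆-erase x≢ρ τ)

erase-⊆ : ∀ x g → erase x g ⊆ g
erase-⊆ x g = filter-⊆ (λ y → ¬? (x ≟ y)) g

-- The pair 22 of an occurrence of 3122 in which `L` is the 3.
Repeats : ℕ → Word → Set
Repeats L r = ∃ λ b → b < L × b ∷ b ∷ [] ⊆ r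

repeats? : ∀ L r → Dec (Repeats L r)
repeats? L []      = no λ { (_ , _ , ()) }
repeats? L (z ∷ r) = map′ to from (((z <? L) ×-dec (_∈?_ _≟_ z r)) ⊎-dec repeats? L r)
  where
  to : (z < L × z ∈ r) ⊎ Repeats L r → Repeats L (z ∷ r)
  to (inj₁ (z<L , z∈r))   = z , z<L , refl ∷ from∈ z∈r
  to (inj₂ (b , b<L , τ)) = b , b<L , z ∷ʳ τ
  from : Repeats L (z ∷ r) → (z < L × z ∈ r) ⊎ Repeats L r
  from (b , b<L , (.z ∷ʳ τ)) = inj₂ (b , b<L , τ)
  from (b , b<L , (refl ∷ τ)) = inj₁ (b<L , to∈ τ)

-- L is the first letter of the word, and r the part of it to the right of a place that is not
-- preceded by an ascent; free says whether a new least letter may be put into that place.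
free : ℕ → Word → ℕ
free L r = if does (repeats? L r) then 0 else 1

free-no : ∀ {L r} → ¬ Repeats L r → free L r ≡ 1
free-no {L} {r} ¬p = cong (if_then 0 else 1) (dec-false (repeats? L r) ¬p)

free-yes : ∀ {L r} → Repeats L r → free L r ≡ 0
free-yes {L} {r} p = cong (if_then 0 else 1) (dec-true (repeats? L r) p)

-- y is the letter in front of r.
mutual
  slots : ℕ → ℕ → Word → ℕ
  slots L y r = free L r + slotsAfter L y r

  slotsAfter : ℕ → ℕ → Word → ℕ
  slotsAfter L y []      = 0
  slotsAfter L y (z ∷ r) = if does (z ≤? y) then slots L z r else 0

slotCount : Word → ℕ
slotCount []      = 0
slotCount (L ∷ r) = slots L L r

slotsAfter-≤ : ∀ {L y z} r → z ≤ y → slotsAfter L y (z ∷ r) ≡ slots L z r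
slotsAfter-≤ {L} {y} {z} r z≤y = cong (if_then slots L z r else 0) (dec-true (z ≤? y) z≤y)

slotsAfter-> : ∀ {L y z} r → y < z → slotsAfter L y (z ∷ r) ≡ 0
slotsAfter-> {L} {y} {z} r y<z = cong (if_then slots L z r else 0) (dec-false (z ≤? y) (<⇒≱ y<z))

slotsAfter-min : ∀ {L x r} → All (x <_) r → slotsAfter L x r ≡ 0
slotsAfter-min []                  = refl
slotsAfter-min {r = _ ∷ r} (x<z ∷ _) = slotsAfter-> r x<z

mutual
  -- The letters from `L` to `y` decrease weakly, copies of `x` aside, so `L` is the largest
  -- possible 3. Either another copy goes directly in front of `r` or all remaining ones go further
  -- right; thus no word is produced twice.
  place : ℕ → ℕ → ℕ → ℕ → Word → List Word
  place x zero    L y r = [ r ]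
  place x (suc a) L y r =
    (if does (repeats? L r) then [] else map (x ∷_) (place x a L y r)) ++ placeAfter x (suc a) L y r

  placeAfter : ℕ → ℕ → ℕ → ℕ → Word → List Word
  placeAfter x a L y []      = []
  placeAfter x a L y (z ∷ r) = if does (z ≤? y) then map (z ∷_) (place x a L z r) else []

placeAfter-≤ : ∀ {x a L y z} r → z ≤ y → placeAfter x a L y (z ∷ r) ≡ map (z ∷_) (place x a L z r)
placeAfter-≤ {x} {a} {L} {y} {z} r z≤y =
  cong (if_then map (z ∷_) (place x a L z r) else []) (dec-true (z ≤? y) z≤y)

placeAfter-> : ∀ {x a L y z} r → y < z → placeAfter x a L y (z ∷ r) ≡ []
placeAfter-> {x} {a} {L} {y} {z} r y<z =
  cong (if_then map (z ∷_) (place x a L z r) else []) (dec-false (z ≤? y) (<⇒≱ y<z))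

mutual
  -- At the front no larger letter precedes `x`, so it is always allowed there. Further right the
  -- first letter of `v` serves as `L`.
  insert : ℕ → ℕ → Word → List Word
  insert x zero    v = [ v ]
  insert x (suc a) v = map (x ∷_) (insert x a v) ++ insertAfter x (suc a) v

  insertAfter : ℕ → ℕ → Word → List Word
  insertAfter x a []      = []
  insertAfter x a (L ∷ r) = map (L ∷_) (place x a L L r)

record Inserted (x a : ℕ) (r g : Word) : Set where
  constructor inserted
  field
    erased  : erase x g ≡ r
    counted : occurrences x g ≡ a

inserted-zero : ∀ {x r} → All (x <_) r → Inserted x 0 r r
inserted-zero x<r = inserted (erase-absent x<r) (occurrences-absent x<r)

inserted-here : ∀ {x a r g} → Inserted x a r g → Inserted x (suc a) r (x ∷ g)
inserted-here {x} {g = g} (inserted e o) =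
  inserted (trans (erase-here x g) e) (trans (occurrences-here x g) (cong suc o))

inserted-there : ∀ {x z a r g} → x < z → Inserted x a r g → Inserted x a (z ∷ r) (z ∷ g)
inserted-there {z = z} {g = g} x<z (inserted e o) =
  inserted (trans (erase-there g (<⇒≢ x<z)) (cong (z ∷_) e)) (trans (occurrences-there g (<⇒≢ x<z)) o)

inserted-here⁻ : ∀ {x a r g} → Inserted x (suc a) r (x ∷ g) → Inserted x a r g
inserted-here⁻ {x} {g = g} (inserted e o) =
  inserted (trans (sym (erase-here x g)) e) (suc-injective (trans (sym (occurrences-here x g)) o))

inserted-there⁻ : ∀ {x z a r g} → x ≢ z → Inserted x a r (z ∷ g) →
                  ∃ λ r′ → r ≡ z ∷ r′ × Inserted x a r′ g
inserted-there⁻ {g = g} x≢z (inserted e o) =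
  _ , trans (sym e) (erase-there g x≢z) , inserted refl (trans (sym (occurrences-there g x≢z)) o)

inserted-zero⁻ : ∀ {x r g} → Inserted x 0 r g → r ≡ g
inserted-zero⁻ {g = []}        (inserted e _) = sym e
inserted-zero⁻ {x} {g = z ∷ g} ins with x ≟ z
... | yes refl with () ← trans (sym (occurrences-here x g)) (Inserted.counted ins)
... | no x≢z with inserted-there⁻ x≢z ins
...   | r′ , refl , ins′ = cong (z ∷_) (inserted-zero⁻ ins′)

erase-> : ∀ {x g} → All (x ≤_) g → All (x <_) (erase x g)
erase-> {x} {g} x≤g = All.zipWith (λ (x≤y , x≢y) → ≤∧≢⇒< x≤y x≢y)
  (All-resp-⊆ (erase-⊆ x g) x≤g , All.all-filter (λ y → ¬? (x ≟ y)) g)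

module _ {x L : ℕ} where
  mutual
    place-inserted : ∀ a y {r} → All (x <_) r → All (Inserted x a r) (place x a L y r)
    place-inserted zero    y x<r = inserted-zero x<r ∷ []
    place-inserted (suc a) y {r} x<r with repeats? L r
    ... | yes _ = placeAfter-inserted (suc a) y x<r
    ... | no  _ = All.++⁺ (All.map⁺ (All.map inserted-here (place-inserted a y x<r)))
                          (placeAfter-inserted (suc a) y x<r)

    placeAfter-inserted : ∀ a y {r} → All (x <_) r → All (Inserted x a r) (placeAfter x a L y r)
    placeAfter-inserted a y []                = []
    placeAfter-inserted a y {z ∷ r} (x<z ∷ x<r) with ≤-<-connex z y
    ... | inj₁ z≤y rewrite placeAfter-≤ {x} {a} {L} r z≤y =
      All.map⁺ (All.map (inserted-there x<z) (place-inserted a z x<r))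
    ... | inj₂ y<z rewrite placeAfter-> {x} {a} {L} r y<z = []

mutual
  insert-inserted : ∀ {x} a {v} → All (x <_) v → All (Inserted x a v) (insert x a v)
  insert-inserted zero    x<v = inserted-zero x<v ∷ []
  insert-inserted (suc a) x<v =
    All.++⁺ (All.map⁺ (All.map inserted-here (insert-inserted a x<v))) (insertAfter-inserted (suc a) x<v)

  insertAfter-inserted : ∀ {x} a {v} → All (x <_) v → All (Inserted x a v) (insertAfter x a v)
  insertAfter-inserted a []          = []
  insertAfter-inserted a {L ∷ _} (x<L ∷ x<r) = All.map⁺ (All.map (inserted-there x<L) (place-inserted a L x<r))

-- Two copies of `x` are a pair below `L`, which closes every place in front of them.
free-many : ∀ {x a L r g} → x < L → Inserted x (2 + a) r g → free L g ≡ 0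
free-many {x} {L = L} {g = g} x<L (inserted _ o) = free-yes {r = g} (x , x<L , twice g o)
  where
  twice : ∀ g {a} → occurrences x g ≡ 2 + a → x ∷ x ∷ [] ⊆ g
  twice (z ∷ g) o with x ≟ z
  ... | yes refl = refl ∷ from∈ (∈-occurrences x g (suc-injective (trans (sym (occurrences-here x g)) o)))
  ... | no  x≢z  = z ∷ʳ twice g (trans (sym (occurrences-there g x≢z)) o)

free-repeats : ∀ {x a L r g} → Repeats L r → Inserted x a r g → free L g ≡ 0
free-repeats {x} {g = g} (b , b<L , τ) (inserted refl _) = free-yes {r = g} (b , b<L , ⊆-trans τ (erase-⊆ x g))

occurrences-twice : ∀ {x g} → x ∷ x ∷ [] ⊆ g → 2 ≤ occurrences x g
occurrences-twice {x} {z ∷ g} (.z ∷ʳ τ) with x ≟ z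
... | yes refl = ≤-trans (m≤n⇒m≤1+n (occurrences-twice τ)) (≤-reflexive (sym (occurrences-here x g)))
... | no  x≢z  = ≤-trans (occurrences-twice τ) (≤-reflexive (sym (occurrences-there g x≢z)))
occurrences-twice {x} {.x ∷ g} (refl ∷ τ) =
  ≤-trans (s≤s (filter-some (x ≟_) (to∈ τ))) (≤-reflexive (sym (occurrences-here x g)))

-- A pair of letters `x` would need two copies; any other pair survives the erasure and lies in `r`.
free-single : ∀ {x a L r g} → ¬ Repeats L r → a ≤ 1 → Inserted x a r g → free L g ≡ 1
free-single {x} {g = g} ¬p a≤1 (inserted refl refl) = free-no {r = g} impossible
  where
  impossible : ¬ Repeats _ g
  impossible (b , b<L , τ) with x ≟ b
  ... | yes refl = <⇒≱ (occurrences-twice τ) a≤1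
  ... | no  x≢b  = ¬p (b , b<L , ⊆-erase (x≢b ∷ x≢b ∷ []) τ)

-- Numbers of open places after an insertion

map-const-local : ∀ {A : Set} {h : A → ℕ} {c xs} →
                  All (λ x → h x ≡ c) xs → map h xs ≡ replicate (length xs) c
map-const-local []         = refl
map-const-local (eq ∷ eqs) = cong₂ _∷_ eq (map-const-local eqs)

module _ {x L : ℕ} (x<L : x < L) where
  mutual
    -- Inserting `a` equal copies amounts to choosing a multiset of `a` open places.
    length-place : ∀ a y r → length (place x a L y r) ≡ multichoose a (slots L y r)
    length-place zero    y r = refl
    length-place (suc a) y r with repeats? L r in eq
    ... | yes _ = length-placeAfter a y r
    ... | no  _ = begin
      length (map (x ∷_) (place x a L y r) ++ placeAfter x (suc a) L y r)
        ≡⟨ length-++ (map (x ∷_) (place x a L y r)) ⟩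
      length (map (x ∷_) (place x a L y r)) + length (placeAfter x (suc a) L y r)
        ≡⟨ cong₂ _+_ (trans (length-map (x ∷_) (place x a L y r)) (length-place a y r)) (length-placeAfter a y r) ⟩
      multichoose a (slots L y r) + multichoose (suc a) (slotsAfter L y r)
        -- The recursive call still counts with `free L r`; `eq` evaluates this to 1.
        ≡⟨ cong (λ p → multichoose a ((if does p then 0 else 1) + slotsAfter L y r)
                       + multichoose (suc a) (slotsAfter L y r)) eq ⟩
      multichoose (suc a) (suc (slotsAfter L y r)) ∎
      where open ≡-Reasoning

    length-placeAfter : ∀ a y r → length (placeAfter x (suc a) L y r) ≡ multichoose (suc a) (slotsAfter L y r)
    length-placeAfter a y []      = refl
    length-placeAfter a y (z ∷ r) with ≤-<-connex z y
    ... | inj₁ z≤y rewrite placeAfter-≤ {x} {suc a} {L} r z≤y | slotsAfter-≤ {L} r z≤y =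
      trans (length-map (z ∷_) (place x (suc a) L z r)) (length-place (suc a) z r)
    ... | inj₂ y<z rewrite placeAfter-> {x} {suc a} {L} r y<z | slotsAfter-> {L} r y<z = refl

  -- Each of these words begins with a letter of `r`, and the ascent from `x` to it closes
  -- everything behind.
  slots-min-placeAfter : ∀ {a y r} → All (x <_) r → All (λ g → slotsAfter L x g ≡ 0) (placeAfter x a L y r)
  slots-min-placeAfter []                              = []
  slots-min-placeAfter {a} {y} {z ∷ r} (x<z ∷ _) with ≤-<-connex z y
  ... | inj₁ z≤y rewrite placeAfter-≤ {x} {a} {L} r z≤y = All.map⁺ (All.universal (λ g → slotsAfter-> g x<z) _)
  ... | inj₂ y<z rewrite placeAfter-> {x} {a} {L} r y<z = []

  mutual
    -- A copy of `x` stands at the current place. The place in front of that copy contributes `c`,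
    -- which will be 1 if no further copy follows and 0 otherwise.
    slots-front : ∀ a c {u y r} → x ≤ u → All (x <_) r → ¬ Repeats L r →
                  (∀ {g} → Inserted x a r g → free L (x ∷ g) ≡ c) →
                  map (slots L u) (map (x ∷_) (place x a L y r)) ≡ map (c +_) (clusterFrom a (slotsAfter L y r))
    slots-front a c {u} {y} {r} x≤u x<r ¬p f = begin
      map (slots L u) (map (x ∷_) (place x a L y r))
        ≡⟨ map-∘ (place x a L y r) ⟨
      map (slots L u ∘ (x ∷_)) (place x a L y r)
        ≡⟨ map-cong-local (All.map (λ {g} i → cong₂ _+_ (f i) (slotsAfter-≤ g x≤u)) (place-inserted a y x<r)) ⟩
      map ((c +_) ∘ slots L x) (place x a L y r)
        ≡⟨ map-∘ (place x a L y r) ⟩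
      map (c +_) (map (slots L x) (place x a L y r))
        ≡⟨ cong (map (c +_)) (slots-cluster a y x<r ¬p) ⟩
      map (c +_) (clusterFrom a (slotsAfter L y r)) ∎
      where open ≡-Reasoning

    -- Only places to the right of a copy of `x` at the current place are counted; they end as soon
    -- as a larger letter follows a copy.
    slots-cluster : ∀ a y {r} → All (x <_) r → ¬ Repeats L r →
                    map (slots L x) (place x a L y r) ≡ clusterFrom a (slotsAfter L y r)
    slots-cluster zero    y {r} x<r ¬p = cong [_] (cong₂ _+_ (free-no ¬p) (slotsAfter-min x<r))
    slots-cluster (suc a) y {r} x<r ¬p with repeats? L r
    ... | yes p = contradiction p ¬p
    ... | no  _ = trans (map-++ (slots L x) (map (x ∷_) (place x a L y r)) (placeAfter x (suc a) L y r)) (combine a)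
      where
      t = slotsAfter L y r
      after : ∀ a c → (∀ {g} → Inserted x (suc a) r g → free L g ≡ c) →
              map (slots L x) (placeAfter x (suc a) L y r) ≡ replicate (multichoose (suc a) t) c
      after a c f = trans
        (map-const-local (All.zipWith (λ (i , s) → trans (cong₂ _+_ (f i) s) (+-identityʳ c))
          (placeAfter-inserted (suc a) y x<r , slots-min-placeAfter x<r)))
        (cong (λ n → replicate n c) (length-placeAfter a y r))
      combine : ∀ a → map (slots L x) (map (x ∷_) (place x a L y r)) ++ map (slots L x) (placeAfter x (suc a) L y r)
                ≡ clusterFrom (suc a) t
      -- With one further copy no two copies lie to the right of the place behind the first, so it
      -- stays open; with more it may close, as in the next clause.
      combine zero    = cong₂ _++_
        (slots-front 0 1 {y = y} ≤-refl x<r ¬p (λ i → free-single ¬p ≤-refl (inserted-here i)))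
                                   (after 0 1 (free-single ¬p ≤-refl))
      combine (suc a) = cong₂ _++_
        (trans (slots-front (suc a) 0 ≤-refl x<r ¬p (λ i → free-many x<L (inserted-here i))) (map-id _))
        (after (suc a) 0 (free-many x<L))

  mutual
    -- A closed place stays closed. An open one either receives the first copy or is skipped, which
    -- are the two parts of `innerFrom`.
    slots-place : ∀ a {y r} → x ≤ y → All (x <_) r →
                  map (slots L y) (place x a L y r) ≡ innerFrom a (slots L y r)
    slots-place zero            x≤y x<r = refl
    slots-place (suc a) {y} {r} x≤y x<r with repeats? L r in eq
    ... | yes p = trans (slots-placeAfter a 0 x<r (free-repeats p)) (map-id _)
    ... | no ¬p = trans (map-++ (slots L y) (map (x ∷_) (place x a L y r)) (placeAfter x (suc a) L y r)) (combine a)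
      where
      t = slotsAfter L y r
      combine : ∀ a → map (slots L y) (map (x ∷_) (place x a L y r)) ++ map (slots L y) (placeAfter x (suc a) L y r)
                ≡ innerFrom (suc a) (suc t)
      combine zero    = cong₂ _++_
        (slots-front 0 1 {y = y} x≤y x<r ¬p (λ i → free-single ¬p ≤-refl (inserted-here i)))
                                   (slots-placeAfter 0 1 x<r (free-single ¬p ≤-refl))
      combine (suc a) = cong₂ _++_
        (trans (slots-front (suc a) 0 x≤y x<r ¬p (λ i → free-many x<L (inserted-here i))) (map-id _))
        (trans (slots-placeAfter (suc a) 0 x<r (free-many x<L)) (map-id _))

    -- The skipped place contributes the same `c` for all insertions further right: it depends only
    -- on pairs in `r` and on the number of copies.
    slots-placeAfter : ∀ a c {y r} → All (x <_) r → (∀ {g} → Inserted x (suc a) r g → free L g ≡ c) →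
                       map (slots L y) (placeAfter x (suc a) L y r) ≡ map (c +_) (innerFrom (suc a) (slotsAfter L y r))
    slots-placeAfter a c {y} {[]}    []          f = refl
    slots-placeAfter a c {y} {z ∷ r} (x<z ∷ x<r) f with ≤-<-connex z y
    ... | inj₂ y<z rewrite placeAfter-> {x} {suc a} {L} r y<z | slotsAfter-> {L} r y<z = refl
    ... | inj₁ z≤y rewrite placeAfter-≤ {x} {suc a} {L} r z≤y | slotsAfter-≤ {L} r z≤y = begin
      map (slots L y) (map (z ∷_) (place x (suc a) L z r))
        ≡⟨ map-∘ (place x (suc a) L z r) ⟨
      map (slots L y ∘ (z ∷_)) (place x (suc a) L z r)
        ≡⟨ map-cong-local (All.map (λ {g} i → cong₂ _+_ (f (inserted-there x<z i)) (slotsAfter-≤ g z≤y))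
             (place-inserted (suc a) z x<r)) ⟩
      map ((c +_) ∘ slots L z) (place x (suc a) L z r)
        ≡⟨ map-∘ (place x (suc a) L z r) ⟩
      map (c +_) (map (slots L z) (place x (suc a) L z r))
        ≡⟨ cong (map (c +_)) (slots-place (suc a) (<⇒≤ x<z) x<r) ⟩
      map (c +_) (innerFrom (suc a) (slots L z r)) ∎
      where open ≡-Reasoning

-- Once `x` leads the word, it is the bound for pairs, and no letter lies below it.
free-least : ∀ {x a v g} → All (x <_) v → Inserted x a v g → free x g ≡ 1
free-least {g = g} x<v (inserted refl _) = free-no {r = g} λ (b , b<x , τ) →
  <-asym b<x (All.head (All-resp-⊆ (⊆-erase (≢-sym (<⇒≢ b<x) ∷ ≢-sym (<⇒≢ b<x) ∷ []) τ) x<v))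

slots-leading : ∀ {x} a {v} → All (x <_) v →
                map (slots x x) (insert x a v) ≡ leadingFrom a (slotCount v)
slots-leading {x} zero    x<v = cong [_] (cong₂ _+_ (free-least x<v (inserted-zero x<v)) (slotsAfter-min x<v))
slots-leading {x} (suc a) {v} x<v = begin
  map (slots x x) (map (x ∷_) (insert x a v) ++ insertAfter x (suc a) v)
    ≡⟨ map-++ (slots x x) (map (x ∷_) (insert x a v)) _ ⟩
  map (slots x x) (map (x ∷_) (insert x a v)) ++ map (slots x x) (insertAfter x (suc a) v)
    ≡⟨ cong₂ _++_ (sym (map-∘ (insert x a v))) (after v x<v) ⟩
  map (slots x x ∘ (x ∷_)) (insert x a v) ++ replicate (multichoose (suc a) (slotCount v)) 1
    ≡⟨ cong (_++ _) (map-cong-local (All.map (λ {g} i →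
         cong₂ _+_ (free-least x<v (inserted-here i)) (slotsAfter-≤ g ≤-refl)) (insert-inserted a x<v))) ⟩
  map (ℕ.suc ∘ slots x x) (insert x a v) ++ replicate (multichoose (suc a) (slotCount v)) 1
    ≡⟨ cong (_++ _) (trans (map-∘ (insert x a v)) (cong (map suc) (slots-leading a x<v))) ⟩
  leadingFrom (suc a) (slotCount v) ∎
  where
  open ≡-Reasoning
  after : ∀ v → All (x <_) v →
          map (slots x x) (insertAfter x (suc a) v) ≡ replicate (multichoose (suc a) (slotCount v)) 1
  after []      []          = refl
  after (L ∷ r) (x<L ∷ x<r) = trans
    (map-const-local (All.map⁺ (All.map (λ {g} i →
      cong₂ _+_ (free-least (x<L ∷ x<r) (inserted-there x<L i)) (slotsAfter-> g x<L)) (place-inserted (suc a) L x<r))))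
    (cong (λ n → replicate n 1)
      (trans (length-map (L ∷_) (place x (suc a) L L r)) (length-place x<L (suc a) L r)))

-- The new numbers of places depend on `v` only through `slotCount v`; this is what reduces words to
-- paths.
slotCount-insert : ∀ {x} a {v} → All (x <_) v → map slotCount (insert x a v) ≡ next a (slotCount v)
slotCount-insert     zero            x<v = refl
slotCount-insert {x} (suc a) {v} x<v = trans
  (map-++ slotCount (map (x ∷_) (insert x a v)) (insertAfter x (suc a) v))
  (cong₂ _++_ (trans (sym (map-∘ (insert x a v))) (slots-leading a x<v)) (after v x<v))
  where
  after : ∀ v → All (x <_) v → map slotCount (insertAfter x (suc a) v) ≡ innerFrom (suc a) (slotCount v)
  after []      []          = refl
  after (L ∷ r) (x<L ∷ x<r) = trans
    (sym (map-∘ (place x (suc a) L L r)))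
    (trans (map-cong-local (All.universal (λ g → refl) (place x (suc a) L L r)))
           (slots-place x<L (suc a) (<⇒≤ x<L) x<r))

-- Words avoiding 231 and 3122

-- Occurrences of 231 or 3122 in which the letter x plays the role of 1.
BadAt : ℕ → Word → Set
BadAt x w = (∃ λ y → ∃ λ z → x < y × y < z × y ∷ z ∷ x ∷ [] ⊆ w) ⊎
            (∃ λ y → ∃ λ z → x < y × y < z × z ∷ x ∷ y ∷ y ∷ [] ⊆ w)

Bad : Word → Set
Bad w = ∃ λ x → BadAt x w

badAt-⊆ : ∀ {x v w} → v ⊆ w → BadAt x v → BadAt x w
badAt-⊆ v⊆w (inj₁ (y , z , x<y , y<z , τ)) = inj₁ (y , z , x<y , y<z , ⊆-trans τ v⊆w)
badAt-⊆ v⊆w (inj₂ (y , z , x<y , y<z , τ)) = inj₂ (y , z , x<y , y<z , ⊆-trans τ v⊆w)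

badAt-∈ : ∀ {x w} → BadAt x w → x ∈ w
badAt-∈ (inj₁ (_ , _ , _ , _ , τ)) = to∈ (∷ˡ⁻ (∷ˡ⁻ τ))
badAt-∈ (inj₂ (_ , _ , _ , _ , τ)) = to∈ (∷ˡ⁻ τ)

badAt-erase : ∀ {x x′ w} → x < x′ → BadAt x′ w → BadAt x′ (erase x w)
badAt-erase x<x′ (inj₁ (y , z , x′<y , y<z , τ)) =
  let x≢y = <⇒≢ (<-trans x<x′ x′<y) ; x≢z = <⇒≢ (<-trans x<x′ (<-trans x′<y y<z)) in
  inj₁ (y , z , x′<y , y<z , ⊆-erase (x≢y ∷ x≢z ∷ <⇒≢ x<x′ ∷ []) τ)
badAt-erase x<x′ (inj₂ (y , z , x′<y , y<z , τ)) =
  let x≢y = <⇒≢ (<-trans x<x′ x′<y) ; x≢z = <⇒≢ (<-trans x<x′ (<-trans x′<y y<z)) in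
  inj₂ (y , z , x′<y , y<z , ⊆-erase (x≢z ∷ <⇒≢ x<x′ ∷ x≢y ∷ x≢y ∷ []) τ)

-- If the 1 of an occurrence exceeds `x`, so do all its letters, and erasing `x` keeps it.
bad-split : ∀ {x w} → All (x ≤_) w → Bad w → BadAt x w ⊎ Bad (erase x w)
bad-split x≤w (x′ , b) with m≤n⇒m<n∨m≡n (All.lookup x≤w (badAt-∈ b))
... | inj₁ x<x′ = inj₂ (x′ , badAt-erase x<x′ b)
... | inj₂ refl = inj₁ b

-- The condition BadAt x for a word in which g follows a weakly decreasing sequence of letters,
-- copies of x aside, from L to y.
BadAfter : ℕ → ℕ → ℕ → Word → Set
BadAfter x L y g = (∃ λ b → ∃ λ c → x < b × b < c × b ∷ c ∷ x ∷ [] ⊆ y ∷ g) ⊎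
                   (∃ λ b → x < b × b < L × x ∷ b ∷ b ∷ [] ⊆ g)

badAt⇒badAfter : ∀ {x L g} → x < L → BadAt x (L ∷ g) → BadAfter x L L g
badAt⇒badAfter _ (inj₁ p) = inj₁ p
badAt⇒badAfter {L = L} x<L (inj₂ (y , z , x<y , y<z , (.L ∷ʳ τ))) with ≤-<-connex z L
-- As `z ≤ L`, the first letter can replace `z` as the 3.
... | inj₁ z≤L = inj₂ (y , x<y , <-≤-trans y<z z≤L , ∷ˡ⁻ τ)
-- Here `L`, `z` and the `x` behind them form a 231.
... | inj₂ L<z = inj₁ (L , z , x<L , L<z , refl ∷ ⊆-trans (refl ∷ refl ∷ minimum _) τ)
badAt⇒badAfter _ (inj₂ (y , z , x<y , y<z , (refl ∷ τ))) = inj₂ (y , x<y , y<z , τ)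

badAfter⇒badAt : ∀ {x L g} → BadAfter x L L g → BadAt x (L ∷ g)
badAfter⇒badAt (inj₁ p)                   = inj₁ p
badAfter⇒badAt (inj₂ (b , x<b , b<L , τ)) = inj₂ (b , _ , x<b , b<L , refl ∷ τ)

badAt-tail : ∀ {x w} → BadAt x (x ∷ w) → BadAt x w
badAt-tail (inj₁ (y , z , x<y , y<z , (_ ∷ʳ τ)))   = inj₁ (y , z , x<y , y<z , τ)
badAt-tail (inj₁ (y , z , x<y , y<z , (refl ∷ τ))) = contradiction x<y (n≮n _)
badAt-tail (inj₂ (y , z , x<y , y<z , (_ ∷ʳ τ)))   = inj₂ (y , z , x<y , y<z , τ)
badAt-tail (inj₂ (y , z , x<y , y<z , (refl ∷ τ))) = contradiction (<-trans x<y y<z) (n≮n _)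

badAfter-min : ∀ {x L y g} → x < y → BadAfter x L y g → x ∈ g
badAfter-min x<y (inj₁ (b , c , x<b , b<c , (_ ∷ʳ τ)))   = to∈ (∷ˡ⁻ (∷ˡ⁻ τ))
badAfter-min x<y (inj₁ (b , c , x<b , b<c , (refl ∷ τ))) = to∈ (∷ˡ⁻ τ)
badAfter-min x<y (inj₂ (b , _ , _ , τ))                  = to∈ τ

-- With only `y` in front of it, the new `x` cannot end a 231. It can only be the 1 of a 3122, whose
-- pair then lies in `erase x g`.
badAfter-here : ∀ {x L y g} → BadAfter x L y (x ∷ g) → BadAfter x L y g ⊎ Repeats L (erase x g)
badAfter-here (inj₁ (b , c , x<b , b<c , (_ ∷ʳ _ ∷ʳ τ)))   = inj₁ (inj₁ (b , c , x<b , b<c , _ ∷ʳ τ))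
badAfter-here (inj₁ (b , c , x<b , b<c , (_ ∷ʳ refl ∷ τ))) = contradiction x<b (n≮n _)
badAfter-here (inj₁ (b , c , x<b , b<c , (refl ∷ _ ∷ʳ τ))) = inj₁ (inj₁ (b , c , x<b , b<c , refl ∷ τ))
badAfter-here (inj₁ (b , c , x<b , b<c , (refl ∷ refl ∷ τ))) = contradiction (<-trans x<b b<c) (n≮n _)
badAfter-here (inj₂ (b , x<b , b<L , (_ ∷ʳ τ)))   = inj₁ (inj₂ (b , x<b , b<L , τ))
badAfter-here (inj₂ (b , x<b , b<L , (refl ∷ τ))) =
  inj₂ (b , b<L , ⊆-erase (<⇒≢ x<b ∷ <⇒≢ x<b ∷ []) τ)

badAfter-∷ : ∀ {x L y g} → BadAfter x L y g → BadAfter x L y (x ∷ g)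
badAfter-∷ (inj₁ (b , c , x<b , b<c , τ)) = inj₁ (b , c , x<b , b<c , ⊆-trans τ (refl ∷ _ ∷ʳ ⊆-refl))
badAfter-∷ (inj₂ (b , x<b , b<L , τ))     = inj₂ (b , x<b , b<L , _ ∷ʳ τ)

badAfter-there : ∀ {x L y z g} → x < z → z ≤ y → BadAfter x L y (z ∷ g) → BadAfter x L z g
badAfter-there x<z z≤y (inj₁ (b , c , x<b , b<c , (_ ∷ʳ τ)))   = inj₁ (b , c , x<b , b<c , τ)
badAfter-there x<z z≤y (inj₁ (b , c , x<b , b<c , (refl ∷ refl ∷ τ))) = contradiction b<c (≤⇒≯ z≤y)
-- The ascent may start at `z` instead of `y`, since z ≤ y < c.
badAfter-there x<z z≤y (inj₁ (b , c , x<b , b<c , (refl ∷ _ ∷ʳ τ))) =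
  inj₁ (_ , c , x<z , ≤-<-trans z≤y b<c , refl ∷ τ)
badAfter-there x<z z≤y (inj₂ (b , x<b , b<L , (_ ∷ʳ τ)))   = inj₂ (b , x<b , b<L , τ)
badAfter-there x<z z≤y (inj₂ (b , x<b , b<L , (refl ∷ τ))) = contradiction x<z (n≮n _)

badAfter-weaken : ∀ {x L y z g} → BadAfter x L z g → BadAfter x L y (z ∷ g)
badAfter-weaken (inj₁ (b , c , x<b , b<c , τ)) = inj₁ (b , c , x<b , b<c , _ ∷ʳ τ)
badAfter-weaken (inj₂ (b , x<b , b<L , τ))     = inj₂ (b , x<b , b<L , _ ∷ʳ τ)

module _ {x L : ℕ} where
  mutual
    place-¬bad : ∀ a {y r g} → x < y → All (x <_) r → g ∈ place x a L y r → ¬ BadAfter x L y g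
    place-¬bad zero    x<y x<r (here refl) bad = n≮n x (All.lookup x<r (badAfter-min x<y bad))
    place-¬bad (suc a) {y} {r} x<y x<r g∈ bad with repeats? L r
    ... | yes _ = placeAfter-¬bad a x<y x<r g∈ bad
    ... | no ¬p with ∈-++⁻ (map (x ∷_) (place x a L y r)) g∈
    ...   | inj₂ g∈′ = placeAfter-¬bad a x<y x<r g∈′ bad
    ...   | inj₁ g∈′ with ∈-map⁻ (x ∷_) g∈′
    ...     | g′ , g′∈ , refl with badAfter-here bad
    ...       | inj₁ bad′     = place-¬bad a x<y x<r g′∈ bad′
    ...       | inj₂ repeated =
      ¬p (subst (Repeats L) (Inserted.erased (All.lookup (place-inserted a y x<r) g′∈)) repeated)

    placeAfter-¬bad : ∀ a {y r g} → x < y → All (x <_) r → g ∈ placeAfter x (suc a) L y r → ¬ BadAfter x L y g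
    placeAfter-¬bad a {y} {z ∷ r} x<y (x<z ∷ x<r) g∈ bad with ≤-<-connex z y
    ... | inj₂ y<z with () ← subst (_ ∈_) (placeAfter-> {x} {suc a} {L} r y<z) g∈
    ... | inj₁ z≤y with ∈-map⁻ (z ∷_) (subst (_ ∈_) (placeAfter-≤ {x} {suc a} {L} r z≤y) g∈)
    ...   | g′ , g′∈ , refl = place-¬bad (suc a) x<z x<r g′∈ (badAfter-there x<z z≤y bad)

  -- What `place` omits is bad: a copy in front of a pair below `L`, or a copy still to come behind
  -- the ascent from `y` to `z`.
  place-complete : ∀ a {y r} g → x < y → All (x ≤_) g → Inserted x a r g →
                   ¬ BadAfter x L y g → g ∈ place x a L y r
  place-complete zero g x<y x≤g ins ¬bad = here (sym (inserted-zero⁻ ins))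
  place-complete (suc a) {y} {r} (z ∷ g) x<y (x≤z ∷ x≤g) ins ¬bad with x ≟ z
  ... | yes refl with repeats? L r
  ...   | yes (b , b<L , τ) with inserted-here⁻ ins
  ...     | inserted refl _ = contradiction
              (inj₂ (b , All.head (All-resp-⊆ τ (erase-> x≤g)) , b<L , refl ∷ ⊆-trans τ (erase-⊆ x g))) ¬bad
  place-complete (suc a) {y} {r} (z ∷ g) x<y (x≤z ∷ x≤g) ins ¬bad | yes refl | no _ =
    ∈-++⁺ˡ (∈-map⁺ (x ∷_) (place-complete a g x<y x≤g (inserted-here⁻ ins) (¬bad ∘ badAfter-∷)))
  place-complete (suc a) {y} {r} (z ∷ g) x<y (x≤z ∷ x≤g) ins ¬bad | no x≢z
    with inserted-there⁻ x≢z ins | ≤-<-connex z y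
  ... | r′ , refl , ins′ | inj₂ y<z = contradiction
    (inj₁ (y , z , x<y , y<z , refl ∷ refl ∷ from∈ (∈-occurrences x g (Inserted.counted ins′)))) ¬bad
  ... | r′ , refl , ins′ | inj₁ z≤y = ∈-++⁺ʳ
    (if does (repeats? L (z ∷ r′)) then [] else map (x ∷_) (place x a L y (z ∷ r′)))
    (subst (_ ∈_) (sym (placeAfter-≤ {x} {suc a} {L} r′ z≤y))
      (∈-map⁺ (z ∷_) (place-complete (suc a) g (≤∧≢⇒< x≤z x≢z) x≤g ins′ (¬bad ∘ badAfter-weaken))))

insert-¬bad : ∀ {x} a {v w} → All (x <_) v → w ∈ insert x a v → ¬ BadAt x w
insert-¬bad zero    x<v (here refl) bad = n≮n _ (All.lookup x<v (badAt-∈ bad))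
insert-¬bad {x} (suc a) {v} x<v w∈ bad with ∈-++⁻ (map (x ∷_) (insert x a v)) w∈
... | inj₁ w∈′ with ∈-map⁻ (x ∷_) w∈′
...   | w′ , w′∈ , refl = insert-¬bad a x<v w′∈ (badAt-tail bad)
insert-¬bad {x} (suc a) {L ∷ r} (x<L ∷ x<r) w∈ bad | inj₂ w∈′ with ∈-map⁻ (L ∷_) w∈′
... | g , g∈ , refl = place-¬bad (suc a) x<L x<r g∈ (badAt⇒badAfter x<L bad)

insert-complete : ∀ {x} a {v} w → All (x ≤_) w → Inserted x a v w → ¬ BadAt x w → w ∈ insert x a v
insert-complete zero w x≤w ins ¬bad = here (sym (inserted-zero⁻ ins))
insert-complete {x} (suc a) {v} (L ∷ g) (x≤L ∷ x≤g) ins ¬bad with x ≟ L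
... | yes refl = ∈-++⁺ˡ (∈-map⁺ (x ∷_)
  (insert-complete a g x≤g (inserted-here⁻ ins) (¬bad ∘ badAt-⊆ (_ ∷ʳ ⊆-refl))))
... | no x≢L with inserted-there⁻ x≢L ins
...   | r , refl , ins′ = ∈-++⁺ʳ (map (x ∷_) (insert x a v))
  (∈-map⁺ (L ∷_) (place-complete (suc a) g (≤∧≢⇒< x≤L x≢L) x≤g ins′ (¬bad ∘ badAfter⇒badAt)))

-- Generating the avoiding words with given multiplicities

generate : ℕ → List ℕ → List Word
generate x []       = [ [] ]
generate x (a ∷ as) = concatMap (insert x a) (generate (suc x) as)

-- Peels off the least letter first, in step with the recursion of `generate`.
Content : ℕ → List ℕ → Word → Set
Content x []       w = w ≡ []
Content x (a ∷ as) w = All (x ≤_) w × occurrences x w ≡ a × Content (suc x) as (erase x w)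

content-≥ : ∀ {x} as {w} → Content x as w → All (x ≤_) w
content-≥ []       refl      = []
content-≥ (_ ∷ as) (x≤w , _) = x≤w

inserted-≥ : ∀ {x a v w} → All (x <_) v → Inserted x a v w → All (x ≤_) w
inserted-≥ {w = []}        x<v ins = []
inserted-≥ {x} {w = z ∷ w} x<v ins with x ≟ z
inserted-≥ {x} {zero}  {w = z ∷ w} x<v ins | yes refl
  with () ← trans (sym (occurrences-here x w)) (Inserted.counted ins)
inserted-≥ {x} {suc a} {w = z ∷ w} x<v ins | yes refl = ≤-refl ∷ inserted-≥ x<v (inserted-here⁻ ins)
... | no x≢z with inserted-there⁻ x≢z ins
inserted-≥ {x} {w = z ∷ w} (x<z ∷ x<v) ins | no x≢z | v , refl , ins′ = <⇒≤ x<z ∷ inserted-≥ x<v ins′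

generate-sound : ∀ x as {w} → w ∈ generate x as → Content x as w × ¬ Bad w
generate-sound x []       (here refl) = refl , λ { (_ , inj₁ (_ , _ , _ , _ , ())) ; (_ , inj₂ (_ , _ , _ , _ , ())) }
generate-sound x (a ∷ as) {w} w∈ with find (∈-concatMap⁻ (insert x a) {xs = generate (suc x) as} w∈)
... | u , u∈ , w∈u with generate-sound (suc x) as u∈
...   | content , ¬bad with content-≥ as content
...     | x<u with All.lookup (insert-inserted a x<u) w∈u
...       | ins@(inserted refl count) = (inserted-≥ x<u ins , count , content) , notBad
  where
  notBad : ¬ Bad w
  notBad bad with bad-split (inserted-≥ x<u ins) bad
  ... | inj₁ at-x = insert-¬bad a x<u w∈u at-x
  ... | inj₂ above = ¬bad above

generate-complete : ∀ x as {w} → Content x as w → ¬ Bad w → w ∈ generate x as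
generate-complete x []       refl ¬bad = here refl
generate-complete x (a ∷ as) {w} (x≤w , count , content) ¬bad = ∈-concatMap⁺ (insert x a) (lose
  (generate-complete (suc x) as content (λ (x′ , b) → ¬bad (x′ , badAt-⊆ (erase-⊆ x w) b)))
  (insert-complete a w x≤w (inserted refl count) (λ b → ¬bad (x , b))))

-- The empty word has no inner place, hence the start at 0.
slotCount-generate : ∀ x as → map slotCount (generate x as) ≡ walk as 0
slotCount-generate x []       = refl
slotCount-generate x (a ∷ as) = begin
  map slotCount (concatMap (insert x a) us)         ≡⟨ map-concatMap slotCount (insert x a) us ⟩
  concatMap (map slotCount ∘ insert x a) us         ≡⟨ cong concat (map-cong-local (All.tabulate λ u∈ →
                                                         slotCount-insert a (content-≥ as (proj₁ (generate-sound (suc x) as u∈))))) ⟩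
  concatMap (next a ∘ slotCount) us                 ≡⟨ concatMap-map (next a) slotCount us ⟨
  concatMap (next a) (map slotCount us)             ≡⟨ cong (concatMap (next a)) (slotCount-generate (suc x) as) ⟩
  concatMap (next a) (walk as 0)                    ∎
  where
  open ≡-Reasoning
  us = generate (suc x) as

length-generate : ∀ x as → length (generate x as) ≡ length (walk as 0)
length-generate x as = trans (sym (length-map slotCount (generate x as))) (cong length (slotCount-generate x as))

heads-disjoint : ∀ {x z : ℕ} {us vs : List Word} → x ≢ z → Disjoint (map (x ∷_) us) (map (z ∷_) vs)
heads-disjoint {x} {z} x≢z (∈x , ∈z) with ∈-map⁻ (x ∷_) ∈x | ∈-map⁻ (z ∷_) ∈z
... | _ , _ , refl | _ , _ , eq = x≢z (∷-injectiveˡ eq)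

mutual
  place-unique : ∀ {x L} a y {r} → All (x <_) r → Unique (place x a L y r)
  place-unique zero    y x<r = [] ∷ []
  place-unique {x} {L} (suc a) y {r} x<r with repeats? L r
  ... | yes _ = placeAfter-unique (suc a) y x<r
  ... | no  _ = Unique.++⁺ (Unique.map⁺ ∷-injectiveʳ (place-unique a y x<r)) (placeAfter-unique (suc a) y x<r)
                  (disjoint x<r)
    where
    disjoint : ∀ {r us} → All (x <_) r → Disjoint (map (x ∷_) us) (placeAfter x (suc a) L y r)
    disjoint {z ∷ r} (x<z ∷ _) with ≤-<-connex z y
    ... | inj₁ z≤y rewrite placeAfter-≤ {x} {suc a} {L} r z≤y = heads-disjoint (<⇒≢ x<z)
    ... | inj₂ y<z rewrite placeAfter-> {x} {suc a} {L} r y<z = λ ()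

  placeAfter-unique : ∀ {x L} a y {r} → All (x <_) r → Unique (placeAfter x a L y r)
  placeAfter-unique a y []                = []
  placeAfter-unique {x} {L} a y {z ∷ r} (_ ∷ x<r) with ≤-<-connex z y
  ... | inj₁ z≤y rewrite placeAfter-≤ {x} {a} {L} r z≤y = Unique.map⁺ ∷-injectiveʳ (place-unique a z x<r)
  ... | inj₂ y<z rewrite placeAfter-> {x} {a} {L} r y<z = []

insert-unique : ∀ {x} a {v} → All (x <_) v → Unique (insert x a v)
insert-unique     zero            x<v           = [] ∷ []
insert-unique     (suc a) {[]}    []            =
  Unique.++⁺ (Unique.map⁺ ∷-injectiveʳ (insert-unique a [])) [] (λ ())
insert-unique {x} (suc a) {L ∷ r} (x<L ∷ x<r) = Unique.++⁺
  (Unique.map⁺ ∷-injectiveʳ (insert-unique a (x<L ∷ x<r)))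
  (Unique.map⁺ ∷-injectiveʳ (place-unique (suc a) L x<r))
  (heads-disjoint (<⇒≢ x<L))

-- Different entries have disjoint outputs because `g` recovers the entry from the output.
concatMap-unique : ∀ {A B : Set} {f : A → List B} (g : B → A) {xs} →
                   All (Unique ∘ f) xs → All (λ x → All (λ y → g y ≡ x) (f x)) xs →
                   Unique xs → Unique (concatMap f xs)
concatMap-unique g []       []       []            = []
concatMap-unique {f = f} g (u ∷ us) (e ∷ es) (x∉ ∷ unique) =
  Unique.++⁺ u (concatMap-unique g us es unique) λ (y∈ , y∈′) →
    let (x′ , x′∈ , y∈x′) = find (∈-concatMap⁻ f y∈′) in
    All.lookup x∉ x′∈ (trans (sym (All.lookup e y∈)) (All.lookup (All.lookup es x′∈) y∈x′))

generate-unique : ∀ x as → Unique (generate x as)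
generate-unique x []       = [] ∷ []
generate-unique x (a ∷ as) = concatMap-unique (erase x)
  (All.map (insert-unique a) letters)
  (All.map (λ x<u → All.map Inserted.erased (insert-inserted a x<u)) letters)
  (generate-unique (suc x) as)
  where
  letters : All (All (x <_)) (generate (suc x) as)
  letters = All.tabulate (λ u∈ → content-≥ as (proj₁ (generate-sound (suc x) as u∈)))

-- Pattern containment in terms of sublists

embed : ∀ (φ : ℕ → ℕ) {ρ π} → map φ ρ ⊆ π → ∃ λ (i : Fin (length ρ) → Fin (length π)) →
        (∀ a b → a Fin.< b → i a Fin.< i b) × (∀ a → lookup π (i a) ≡ φ (lookup ρ a))
embed φ {[]}    τ        = (λ ()) , (λ ()) , (λ ())
embed φ {r ∷ ρ} (_ ∷ʳ τ) with embed φ {r ∷ ρ} τ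
... | i , mono , eq = suc ∘ i , (λ a b a<b → s≤s (mono a b a<b)) , eq
embed φ {r ∷ ρ} (p≡ ∷ τ) with embed φ {ρ} τ
... | i , mono , eq = i′ , mono′ , λ { zero → sym p≡ ; (suc a) → eq a }
  where
  i′ : Fin (suc (length ρ)) → Fin _
  i′ zero    = zero
  i′ (suc a) = suc (i a)
  mono′ : ∀ a b → a Fin.< b → i′ a Fin.< i′ b
  mono′ zero    (suc b) _         = s≤s z≤n
  mono′ (suc a) (suc b) (s≤s a<b) = s≤s (mono a b a<b)

-- The first index decides whether the head of `π` is used. As `i` increases, the remaining indices
-- are positive and can be lowered by one.
unembed : ∀ (φ : ℕ → ℕ) ρ π (i : Fin (length ρ) → Fin (length π)) →
          (∀ a b → a Fin.< b → i a Fin.< i b) → (∀ a → lookup π (i a) ≡ φ (lookup ρ a)) → map φ ρ ⊆ π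
unembed φ []      π       i mono eq = minimum π
unembed φ (r ∷ ρ) []      i mono eq with () ← i zero
unembed φ (r ∷ ρ) (p ∷ π) i mono eq with i zero in i₀
... | zero  = trans (sym (eq zero)) (cong (lookup (p ∷ π)) i₀) ∷
  unembed φ ρ π (proj₁ ∘ lowered)
    (λ a b a<b → ≤-pred
      (subst₂ Fin._<_ (proj₂ (lowered a)) (proj₂ (lowered b)) (mono (suc a) (suc b) (s≤s a<b))))
    (λ a → trans (sym (cong (lookup (p ∷ π)) (proj₂ (lowered a)))) (eq (suc a)))
  where
  lowered : ∀ a → ∃ λ j → i (suc a) ≡ suc j
  lowered a with i (suc a) | mono zero (suc a) (s≤s z≤n)
  ... | suc j | _    = j , refl
  ... | zero  | i₀<0 with () ← subst (λ j → toℕ j < 0) i₀ i₀<0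
... | suc k = p ∷ʳ unembed φ (r ∷ ρ) π (proj₁ ∘ lowered)
    (λ a b a<b → ≤-pred (subst₂ Fin._<_ (proj₂ (lowered a)) (proj₂ (lowered b)) (mono a b a<b)))
    (λ a → trans (sym (cong (lookup (p ∷ π)) (proj₂ (lowered a)))) (eq a))
  where
  lowered : ∀ a → ∃ λ j → i a ≡ suc j
  lowered zero    = k , i₀
  lowered (suc a) with i (suc a) | mono zero (suc a) (s≤s z≤n)
  ... | suc j | _ = j , refl

-- Sends the pattern letters 1, 2, 3 to `x`, `y`, `z` and goes on with z + 1, z + 2, ... so as to
-- increase strictly on all positive letters; 0 gets a default value.
value : ℕ → ℕ → ℕ → ℕ → ℕ
value x y z 1                   = x
value x y z 2                   = y
value x y z (suc (suc (suc n))) = n + z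
value x y z 0                   = 0

value-mono : ∀ {x y z} → x < y → y < z → ∀ {m n} → 1 ≤ m → m < n → value x y z m < value x y z n
value-mono x<y y<z {1} {2}                   _ _ = x<y
value-mono x<y y<z {1} {suc (suc (suc n))}   _ _ = ≤-trans (<-trans x<y y<z) (m≤n+m _ n)
value-mono x<y y<z {2} {suc (suc (suc n))}   _ _ = ≤-trans y<z (m≤n+m _ n)
value-mono x<y y<z {suc (suc (suc m))} {suc (suc (suc n))} _ (s≤s (s≤s (s≤s m<n))) = +-monoˡ-< _ m<n
value-mono x<y y<z {1} {1} _ (s≤s ())
value-mono x<y y<z {2} {1} _ (s≤s ())
value-mono x<y y<z {2} {2} _ (s≤s (s≤s ()))
value-mono x<y y<z {suc (suc (suc m))} {2} _ (s≤s (s≤s ()))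

value-⇔ : ∀ {x y z} → x < y → y < z → ∀ {m n} → 1 ≤ m → 1 ≤ n → value x y z m < value x y z n ⇔ m < n
value-⇔ {x} {y} {z} x<y y<z {m} {n} 1≤m 1≤n = mk⇔ from (value-mono x<y y<z 1≤m)
  where
  from : value x y z m < value x y z n → m < n
  from v<v with <-cmp m n
  ... | tri< m<n _ _ = m<n
  ... | tri≈ _ refl _ = contradiction v<v (n≮n _)
  ... | tri> _ _ n<m = contradiction v<v (<-asym (value-mono x<y y<z 1≤n n<m))

Occurs : Word → Word → Set
Occurs ρ π = ∃ λ x → ∃ λ y → ∃ λ z → x < y × y < z × map (value x y z) ρ ⊆ π

occurs⇒contains : ∀ ρ π → All (1 ≤_) ρ → Occurs ρ π → π contains ρ
occurs⇒contains ρ π 1≤ρ (x , y , z , x<y , y<z , τ) with embed (value x y z) τ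
... | i , mono , eq = i , mono , λ a b → iff a b , iff b a
  where
  iff : ∀ a b → lookup π (i a) < lookup π (i b) ⇔ lookup ρ a < lookup ρ b
  iff a b = subst₂ (λ u v → u < v ⇔ lookup ρ a < lookup ρ b) (sym (eq a)) (sym (eq b))
    (value-⇔ x<y y<z (All.lookup 1≤ρ (∈-lookup a)) (All.lookup 1≤ρ (∈-lookup b)))

module _ {ρ π : Word} (c : π contains ρ) where
  private
    letter : Fin (length ρ) → ℕ
    letter a = lookup π (proj₁ c a)

  contains-< : ∀ a b → lookup ρ a < lookup ρ b → letter a < letter b
  contains-< a b = Equivalence.from (proj₁ (proj₂ (proj₂ c) a b))

  -- Containment speaks of strict inequalities only; equality follows by excluding both.
  contains-≡ : ∀ a b → lookup ρ a ≡ lookup ρ b → letter a ≡ letter b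
  contains-≡ a b eq with <-cmp (letter a) (letter b)
  ... | tri< lt _ _ = contradiction eq (<⇒≢ (Equivalence.to (proj₁ (proj₂ (proj₂ c) a b)) lt))
  ... | tri≈ _ e _  = e
  ... | tri> _ _ gt = contradiction eq (>⇒≢ (Equivalence.to (proj₂ (proj₂ (proj₂ c) a b)) gt))

  -- p, q and r are positions of the letters 1, 2 and 3 in ρ.
  contains⇒occurs : ∀ p q r → lookup ρ p < lookup ρ q → lookup ρ q < lookup ρ r →
    (∀ a → letter a ≡ value (letter p) (letter q) (letter r) (lookup ρ a)) → Occurs ρ π
  contains⇒occurs p q r p<q q<r eq =
    _ , _ , _ , contains-< p q p<q , contains-< q r q<r ,
    unembed _ ρ π (proj₁ c) (proj₁ (proj₂ c)) eq

p132 p2213 p213 p1322 : Word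
p132  = 1 ∷ 3 ∷ 2 ∷ []
p2213 = 2 ∷ 2 ∷ 1 ∷ 3 ∷ []
p213  = 2 ∷ 1 ∷ 3 ∷ []
p1322 = 1 ∷ 3 ∷ 2 ∷ 2 ∷ []

1<2 : 1 < 2
1<2 = s≤s (s≤s z≤n)

2<3 : 2 < 3
2<3 = s≤s (s≤s (s≤s z≤n))

occurs-132 : ∀ {π} → π contains p132 → Occurs p132 π
occurs-132 c = contains⇒occurs c 0F 2F 1F 1<2 2<3 λ { 0F → refl ; 1F → refl ; 2F → refl }

occurs-213 : ∀ {π} → π contains p213 → Occurs p213 π
occurs-213 c = contains⇒occurs c 1F 0F 2F 1<2 2<3 λ { 0F → refl ; 1F → refl ; 2F → refl }

occurs-2213 : ∀ {π} → π contains p2213 → Occurs p2213 π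
occurs-2213 {π} c = contains⇒occurs c 2F 0F 3F 1<2 2<3
  λ { 0F → refl ; 1F → contains-≡ {p2213} {π} c 1F 0F refl ; 2F → refl ; 3F → refl }

occurs-1322 : ∀ {π} → π contains p1322 → Occurs p1322 π
occurs-1322 {π} c = contains⇒occurs c 0F 2F 1F 1<2 2<3
  λ { 0F → refl ; 1F → refl ; 2F → refl ; 3F → contains-≡ {p1322} {π} c 3F 2F refl }

-- Reversal and complementation

bad-reverse : ∀ w → Bad (reverse w) ⇔ (Occurs p132 w ⊎ Occurs p2213 w)
bad-reverse w = mk⇔ to from
  where
  unreverse : ∀ {ρ} → ρ ⊆ reverse w → reverse ρ ⊆ w
  unreverse τ = subst (_ ⊆_) (reverse-involutive w) (reverse⁺ τ)
  to : Bad (reverse w) → Occurs p132 w ⊎ Occurs p2213 w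
  to (x , inj₁ (y , z , x<y , y<z , τ)) = inj₁ (x , y , z , x<y , y<z , unreverse τ)
  to (x , inj₂ (y , z , x<y , y<z , τ)) = inj₂ (x , y , z , x<y , y<z , unreverse τ)
  from : Occurs p132 w ⊎ Occurs p2213 w → Bad (reverse w)
  from (inj₁ (x , y , z , x<y , y<z , τ)) = x , inj₁ (y , z , x<y , y<z , reverse⁺ τ)
  from (inj₂ (x , y , z , x<y , y<z , τ)) = x , inj₂ (y , z , x<y , y<z , reverse⁺ τ)

complement : ℕ → Word → Word
complement c = map (c ∸_)

complement-involutive : ∀ {c w} → All (_≤ c) w → complement c (complement c w) ≡ w
complement-involutive {c} {w} w≤c = trans (sym (map-∘ w))
  (trans (map-cong-local (All.map m∸[m∸n]≡n w≤c)) (map-id w))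

complement-bounded : ∀ c w → All (_≤ c) (complement c w)
complement-bounded c w = All.map⁺ (All.universal (m∸n≤m c) w)

-- Complementation exchanges 231 with 213 and 3122 with 1322. The bound `c` makes truncated
-- subtraction an order-reversing involution.
bad-complement : ∀ {c w} → All (_≤ c) w → Bad (complement c w) ⇔ (Occurs p213 w ⊎ Occurs p1322 w)
bad-complement {c} {w} w≤c = mk⇔ to from
  where
  uncomplement : ∀ {ρ} → ρ ⊆ complement c w → complement c ρ ⊆ w
  uncomplement τ = subst (_ ⊆_) (complement-involutive w≤c) (map⁺ (c ∸_) τ)
  bounded : ∀ {ρ} → ρ ⊆ complement c w → All (_≤ c) ρ
  bounded τ = All-resp-⊆ τ (complement-bounded c w)
  to : Bad (complement c w) → Occurs p213 w ⊎ Occurs p1322 w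
  to (x , inj₁ (y , z , x<y , y<z , τ)) with y≤c ∷ z≤c ∷ _ ← bounded τ =
    inj₁ (_ , _ , _ , ∸-monoʳ-< y<z z≤c , ∸-monoʳ-< x<y y≤c , uncomplement τ)
  to (x , inj₂ (y , z , x<y , y<z , τ)) with z≤c ∷ _ ∷ y≤c ∷ _ ← bounded τ =
    inj₂ (_ , _ , _ , ∸-monoʳ-< y<z z≤c , ∸-monoʳ-< x<y y≤c , uncomplement τ)
  from : Occurs p213 w ⊎ Occurs p1322 w → Bad (complement c w)
  from (inj₁ (x , y , z , x<y , y<z , τ)) with y≤c ∷ _ ∷ z≤c ∷ _ ← All-resp-⊆ τ w≤c =
    _ , inj₁ (_ , _ , ∸-monoʳ-< y<z z≤c , ∸-monoʳ-< x<y y≤c , map⁺ (c ∸_) τ)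
  from (inj₂ (x , y , z , x<y , y<z , τ)) with _ ∷ z≤c ∷ y≤c ∷ _ ← All-resp-⊆ τ w≤c =
    _ , inj₂ (_ , _ , ∸-monoʳ-< y<z z≤c , ∸-monoʳ-< x<y y≤c , map⁺ (c ∸_) τ)

avoids-132-2213 : ∀ w → AvoidsAll (p132 ∷ p2213 ∷ []) w ⇔ (¬ Bad (reverse w))
avoids-132-2213 w = mk⇔ to from
  where
  to : AvoidsAll (p132 ∷ p2213 ∷ []) w → ¬ Bad (reverse w)
  to (a₁ ∷ a₂ ∷ []) bad with Equivalence.to (bad-reverse w) bad
  ... | inj₁ o = a₁ (occurs⇒contains p132 w (s≤s z≤n ∷ s≤s z≤n ∷ s≤s z≤n ∷ []) o)
  ... | inj₂ o = a₂ (occurs⇒contains p2213 w (s≤s z≤n ∷ s≤s z≤n ∷ s≤s z≤n ∷ s≤s z≤n ∷ []) o)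
  from : ¬ Bad (reverse w) → AvoidsAll (p132 ∷ p2213 ∷ []) w
  from ¬bad = (λ c → ¬bad (Equivalence.from (bad-reverse w) (inj₁ (occurs-132 {w} c)))) ∷
              (λ c → ¬bad (Equivalence.from (bad-reverse w) (inj₂ (occurs-2213 {w} c)))) ∷ []

avoids-213-1322 : ∀ {c w} → All (_≤ c) w → AvoidsAll (p213 ∷ p1322 ∷ []) w ⇔ (¬ Bad (complement c w))
avoids-213-1322 {c} {w} w≤c = mk⇔ to from
  where
  to : AvoidsAll (p213 ∷ p1322 ∷ []) w → ¬ Bad (complement c w)
  to (a₁ ∷ a₂ ∷ []) bad with Equivalence.to (bad-complement w≤c) bad
  ... | inj₁ o = a₁ (occurs⇒contains p213 w (s≤s z≤n ∷ s≤s z≤n ∷ s≤s z≤n ∷ []) o)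
  ... | inj₂ o = a₂ (occurs⇒contains p1322 w (s≤s z≤n ∷ s≤s z≤n ∷ s≤s z≤n ∷ s≤s z≤n ∷ []) o)
  from : ¬ Bad (complement c w) → AvoidsAll (p213 ∷ p1322 ∷ []) w
  from ¬bad = (λ k → ¬bad (Equivalence.from (bad-complement w≤c) (inj₁ (occurs-213 {w} k)))) ∷
              (λ k → ¬bad (Equivalence.from (bad-complement w≤c) (inj₂ (occurs-1322 {w} k)))) ∷ []

-- Multiplicities of letters

occurrences-↭ : ∀ {v w} → v ↭ w → ∀ x → occurrences x v ≡ occurrences x w
occurrences-↭ v↭w x = ↭-length (filter-↭ (x ≟_) v↭w)

occurrences-map : ∀ {f : ℕ → ℕ} {x x′ w} → All (λ y → x ≡ f y ⇔ x′ ≡ y) w →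
                  occurrences x (map f w) ≡ occurrences x′ w
occurrences-map []                             = refl
occurrences-map {f} {x} {x′} {y ∷ w} (eq ∷ eqs) with x′ ≟ y
... | yes refl rewrite Equivalence.from eq refl =
  trans (occurrences-here (f y) (map f w)) (trans (cong suc (occurrences-map eqs)) (sym (occurrences-here y w)))
... | no  x′≢y = trans (occurrences-there (map f w) (x′≢y ∘ Equivalence.to eq))
                   (trans (occurrences-map eqs) (sym (occurrences-there w x′≢y)))

-- Multipermutations with least letter `x` in place of 1, as the recursion of `Content` requires.
HasContent : ℕ → (n : ℕ) → (Fin n → ℕ) → Word → Set
HasContent x n a w = (∀ i → occurrences (toℕ i + x) w ≡ a i) × All (λ y → x ≤ y × y < n + x) w

occurrences-erase : ∀ {x y} → x ≢ y → ∀ w → occurrences y (erase x w) ≡ occurrences y w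
occurrences-erase         x≢y []      = refl
occurrences-erase {x} {y} x≢y (z ∷ w) with x ≟ z | y ≟ z
... | yes refl | yes refl = contradiction refl x≢y
... | yes refl | no  y≢x  rewrite erase-here x w =
  trans (occurrences-erase x≢y w) (sym (occurrences-there w y≢x))
... | no  x≢z  | yes refl rewrite erase-there w x≢z =
  trans (occurrences-here y (erase x w)) (trans (cong suc (occurrences-erase x≢y w)) (sym (occurrences-here y w)))
... | no  x≢z  | no  y≢z  rewrite erase-there w x≢z =
  trans (occurrences-there (erase x w) y≢z) (trans (occurrences-erase x≢y w) (sym (occurrences-there w y≢z)))

hasContent⇒content : ∀ x n a w → HasContent x n a w → Content x (tabulate a) w
hasContent⇒content x zero    a []    _                         = refl
hasContent⇒content x zero    a (_ ∷ _) (_ , (x≤z , z<x) ∷ _)     = contradiction z<x (≤⇒≯ x≤z)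
hasContent⇒content x (suc n) a w     (count , bounds)          =
  All.map proj₁ bounds , count zero , hasContent⇒content (suc x) n (a ∘ suc) (erase x w)
    ( (λ i → trans (occurrences-erase (<⇒≢ (m≤n+m (suc x) (toℕ i))) w)
                   (trans (cong (λ y → occurrences y w) (+-suc (toℕ i) x)) (count (suc i))))
    , All.zipWith (λ {y} (x<y , (_ , y<n)) → x<y , subst (y <_) (sym (+-suc n x)) y<n)
        (erase-> (All.map proj₁ bounds) , All-resp-⊆ (erase-⊆ x w) bounds))

content⇒hasContent : ∀ x n a w → Content x (tabulate a) w → HasContent x n a w
content⇒hasContent x zero    a [] refl                            = (λ ()) , []
content⇒hasContent x (suc n) a w (x≤w , count , content)
  with content⇒hasContent (suc x) n (a ∘ suc) (erase x w) content
... | counts , bounds = counts′ , All.tabulate bounds′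
  where
  counts′ : ∀ i → occurrences (toℕ i + x) w ≡ a i
  counts′ zero    = count
  counts′ (suc i) = trans (cong (λ y → occurrences y w) (sym (+-suc (toℕ i) x)))
    (trans (sym (occurrences-erase (<⇒≢ (m≤n+m (suc x) (toℕ i))) w)) (counts i))
  bounds′ : ∀ {y} → y ∈ w → x ≤ y × y < suc n + x
  bounds′ {y} y∈w with x ≟ y
  ... | yes refl = ≤-refl , s≤s (m≤n+m x n)
  ... | no  x≢y  with All.lookup bounds (∈-filter⁺ (λ y → ¬? (x ≟ y)) y∈w x≢y)
  ...   | x<y , y<n = <⇒≤ x<y , subst (y <_) (+-suc n x) y<n

-- The left inverse makes `map f xs` duplicate-free, and duplicate-free lists with the same elements
-- are permutations of each other.
length-inverse : ∀ {A B : Set} {xs : List A} {ys : List B} (f : A → B) (g : B → A) →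
  Unique xs → Unique ys →
  (∀ {x} → x ∈ xs → f x ∈ ys × g (f x) ≡ x) → (∀ {y} → y ∈ ys → g y ∈ xs × f (g y) ≡ y) →
  length xs ≡ length ys
length-inverse {xs = xs} {ys} f g uxs uys to from = trans (sym (length-map f xs))
  (↭-length (∼bag⇒↭ (unique∧set⇒bag unique-map uys (mk⇔ to′ from′))))
  where
  unique-map : Unique (map f xs)
  unique-map = Unique.map⁻ {f = g} (subst Unique (sym (trans (sym (map-∘ xs))
    (trans (map-cong-local (All.tabulate (proj₂ ∘ to))) (map-id xs)))) uxs)
  to′ : ∀ {y} → y ∈ map f xs → y ∈ ys
  to′ y∈ with ∈-map⁻ f y∈
  ... | x , x∈ , refl = proj₁ (to x∈)
  from′ : ∀ {y} → y ∈ ys → y ∈ map f xs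
  from′ y∈ = subst (_∈ map f xs) (proj₂ (from y∈)) (∈-map⁺ f (proj₁ (from y∈)))

reverse-tabulate : ∀ {A : Set} {n} (f : Fin n → A) → reverse (tabulate f) ≡ tabulate (f ∘ opposite)
reverse-tabulate {n = zero}  f = refl
reverse-tabulate {n = suc n} f = begin
  reverse (tabulate f)                             ≡⟨ cong reverse (snoc f) ⟩
  reverse (tabulate (f ∘ inject₁) ++ [ f (fromℕ n) ]) ≡⟨ reverse-++ (tabulate (f ∘ inject₁)) _ ⟩
  f (fromℕ n) ∷ reverse (tabulate (f ∘ inject₁))   ≡⟨ cong (f (fromℕ n) ∷_) (reverse-tabulate (f ∘ inject₁)) ⟩
  tabulate (f ∘ opposite)                          ∎
  where
  open ≡-Reasoning
  snoc : ∀ {A : Set} {n} (f : Fin (suc n) → A) → tabulate f ≡ tabulate (f ∘ inject₁) ++ [ f (fromℕ n) ]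
  snoc {n = zero}  f = refl
  snoc {n = suc n} f = cong (f zero ∷_) (snoc (f ∘ suc))

hasContent-complement : ∀ k a w → HasContent 1 k a w → HasContent 1 k (a ∘ opposite) (complement (suc k) w)
hasContent-complement k a w (count , bounds) = counts , All.map⁺ (All.map bounds′ bounds)
  where
  upper : ∀ {y} → y < k + 1 → y ≤ k
  upper y<k = ≤-pred (≤-trans y<k (≤-reflexive (+-comm k 1)))
  bounds′ : ∀ {y} → 1 ≤ y × y < k + 1 → 1 ≤ suc k ∸ y × suc k ∸ y < k + 1
  bounds′ {y} (1≤y , y<k) = m<n⇒0<n∸m (s≤s (upper y<k)) ,
    ≤-trans (s≤s (∸-monoʳ-≤ (suc k) 1≤y)) (≤-reflexive (+-comm 1 k))
  -- Index `i` stands for the letter i + 1, whose complement k - i belongs to the opposite index.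
  mirror : ∀ i → suc k ∸ (toℕ i + 1) ≡ toℕ (opposite i) + 1
  mirror i = begin
    suc k ∸ (toℕ i + 1)     ≡⟨ cong (suc k ∸_) (+-comm (toℕ i) 1) ⟩
    k ∸ toℕ i               ≡⟨ +-∸-assoc 1 (Fin.toℕ<n i) ⟩
    1 + (k ∸ suc (toℕ i))   ≡⟨ cong suc (Fin.opposite-prop i) ⟨
    1 + toℕ (opposite i)    ≡⟨ +-comm 1 (toℕ (opposite i)) ⟩
    toℕ (opposite i) + 1    ∎
    where open ≡-Reasoning
  counts : ∀ i → occurrences (toℕ i + 1) (complement (suc k) w) ≡ a (opposite i)
  counts i = trans
    (occurrences-map (All.map (λ {y} (_ , y<k) → reflect y (m≤n⇒m≤1+n (upper y<k))) bounds))
    (count (opposite i))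
    where
    i≤ : toℕ i + 1 ≤ suc k
    i≤ = ≤-trans (+-monoˡ-≤ 1 (Fin.toℕ≤n i)) (≤-reflexive (+-comm k 1))
    reflect : ∀ y → y ≤ suc k → toℕ i + 1 ≡ suc k ∸ y ⇔ toℕ (opposite i) + 1 ≡ y
    reflect y y≤k = mk⇔
      (λ eq → trans (sym (mirror i)) (trans (cong (suc k ∸_) eq) (m∸[m∸n]≡n y≤k)))
      (λ eq → trans (sym (m∸[m∸n]≡n i≤)) (cong (suc k ∸_) (trans (mirror i) eq)))

-- Both counts as numbers of generated words

module _ (S : Multiset) where
  open Multiset S

  isMultipermutation⇔hasContent : ∀ w → IsMultipermutation S w ⇔ HasContent 1 k a w
  isMultipermutation⇔hasContent w = mk⇔
    (λ (count , bounds) → (λ i → trans (cong (λ y → occurrences y w) (+-comm (toℕ i) 1)) (count i))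
                        , All.map (λ {y} (1≤y , y≤k) → 1≤y , ≤-trans (s≤s y≤k) (≤-reflexive (+-comm 1 k))) bounds)
    (λ (count , bounds) → (λ i → trans (cong (λ y → occurrences y w) (+-comm 1 (toℕ i))) (count i))
                        , All.map (λ {y} (1≤y , y<k) → 1≤y , ≤-pred (≤-trans y<k (≤-reflexive (+-comm k 1)))) bounds)

  isMultipermutation-↭ : ∀ {v w} → v ↭ w → IsMultipermutation S v → IsMultipermutation S w
  isMultipermutation-↭ v↭w (count , bounds) =
    (λ i → trans (sym (occurrences-↭ v↭w (suc (toℕ i)))) (count i)) , All-resp-↭ v↭w bounds

  av-involution : ∀ P as (f : Word → Word) →
    (∀ w → IsMultipermutation S w → AvoidsAll P w → (Content 1 as (f w) × ¬ Bad (f w)) × f (f w) ≡ w) →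
    (∀ v → Content 1 as v → ¬ Bad v → (IsMultipermutation S (f v) × AvoidsAll P (f v)) × f (f v) ≡ v) →
    av S P ≡ length (generate 1 as)
  av-involution P as f to from = length-inverse f f
    (Unique.filter⁺ (avoidsAll? P) (multipermutations-unique S)) (generate-unique 1 as)
    (λ {w} w∈ →
      let (w∈S , avoids) = ∈-filter⁻ (avoidsAll? P) {xs = multipermutations S} w∈
          ((content , ¬bad) , ffw) = to w (Equivalence.to (∈-multipermutations S w) w∈S) avoids
      in generate-complete 1 as content ¬bad , ffw)
    (λ {v} v∈ →
      let (content , ¬bad) = generate-sound 1 as v∈
          ((multi , avoids) , ffv) = from v content ¬bad
      in ∈-filter⁺ (avoidsAll? P) (Equivalence.from (∈-multipermutations S (f v)) multi) avoids , ffv)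

  av-132-2213 : av S (p132 ∷ p2213 ∷ []) ≡ length (generate 1 (tabulate a))
  av-132-2213 = av-involution (p132 ∷ p2213 ∷ []) (tabulate a) reverse to from
    where
    to : ∀ w → IsMultipermutation S w → AvoidsAll (p132 ∷ p2213 ∷ []) w →
         (Content 1 (tabulate a) (reverse w) × ¬ Bad (reverse w)) × reverse (reverse w) ≡ w
    to w multi avoids =
      ( hasContent⇒content 1 k a (reverse w) (Equivalence.to (isMultipermutation⇔hasContent (reverse w))
          (isMultipermutation-↭ (↭-sym (↭-reverse w)) multi))
      , Equivalence.to (avoids-132-2213 w) avoids )
      , reverse-involutive w
    from : ∀ v → Content 1 (tabulate a) v → ¬ Bad v →
           (IsMultipermutation S (reverse v) × AvoidsAll (p132 ∷ p2213 ∷ []) (reverse v)) × reverse (reverse v) ≡ v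
    from v content ¬bad =
      ( isMultipermutation-↭ (↭-sym (↭-reverse v))
          (Equivalence.from (isMultipermutation⇔hasContent v) (content⇒hasContent 1 k a v content))
      , Equivalence.from (avoids-132-2213 (reverse v)) (¬bad ∘ subst Bad (reverse-involutive v)) )
      , reverse-involutive v

  av-213-1322 : av S (p213 ∷ p1322 ∷ []) ≡ length (generate 1 (tabulate (a ∘ opposite)))
  av-213-1322 = av-involution (p213 ∷ p1322 ∷ []) (tabulate (a ∘ opposite)) comp to from
    where
    comp = complement (suc k)
    bounded : ∀ b {w} → HasContent 1 k b w → All (_≤ suc k) w
    bounded _ (_ , bounds) = All.map (λ (_ , y<k) → ≤-trans (<⇒≤ y<k) (≤-reflexive (+-comm k 1))) bounds
    to : ∀ w → IsMultipermutation S w → AvoidsAll (p213 ∷ p1322 ∷ []) w →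
         (Content 1 (tabulate (a ∘ opposite)) (comp w) × ¬ Bad (comp w)) × comp (comp w) ≡ w
    to w multi avoids =
      ( hasContent⇒content 1 k (a ∘ opposite) (comp w) (hasContent-complement k a w content)
      , Equivalence.to (avoids-213-1322 (bounded a content)) avoids )
      , complement-involutive (bounded a content)
      where
      content : HasContent 1 k a w
      content = Equivalence.to (isMultipermutation⇔hasContent w) multi
    from : ∀ v → Content 1 (tabulate (a ∘ opposite)) v → ¬ Bad v →
           (IsMultipermutation S (comp v) × AvoidsAll (p213 ∷ p1322 ∷ []) (comp v)) × comp (comp v) ≡ v
    from v content ¬bad =
      ( Equivalence.from (isMultipermutation⇔hasContent (comp v))
          -- Complementing reverses the already reversed multiplicities and so restores `a`.
          ( (λ i → trans (proj₁ mirrored i) (cong a (Fin.opposite-involutive i))) , proj₂ mirrored )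
      , Equivalence.from (avoids-213-1322 (bounded (a ∘ opposite ∘ opposite) mirrored))
          (¬bad ∘ subst Bad (complement-involutive (bounded (a ∘ opposite) content′))) )
      , complement-involutive (bounded (a ∘ opposite) content′)
      where
      content′ : HasContent 1 k (a ∘ opposite) v
      content′ = content⇒hasContent 1 k (a ∘ opposite) v content
      mirrored : HasContent 1 k (a ∘ opposite ∘ opposite) (comp v)
      mirrored = hasContent-complement k (a ∘ opposite) v content′

theorem2p20 : ((1 ∷ 3 ∷ 2 ∷ []) ∷ (2 ∷ 2 ∷ 1 ∷ 3 ∷ []) ∷ [])
    ∼
    ((2 ∷ 1 ∷ 3 ∷ []) ∷ (1 ∷ 3 ∷ 2 ∷ 2 ∷ []) ∷ [])
theorem2p20 S = begin
  av S (p132 ∷ p2213 ∷ [])                     ≡⟨ av-132-2213 S ⟩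
  length (generate 1 (tabulate a))             ≡⟨ length-generate 1 (tabulate a) ⟩
  length (walk (tabulate a) 0)                 ≡⟨ length-walk-reverse (tabulate a) ⟨
  length (walk (reverse (tabulate a)) 0)       ≡⟨ cong (λ as → length (walk as 0)) (reverse-tabulate a) ⟩
  length (walk (tabulate (a ∘ opposite)) 0)    ≡⟨ length-generate 1 (tabulate (a ∘ opposite)) ⟨
  length (generate 1 (tabulate (a ∘ opposite))) ≡⟨ av-213-1322 S ⟨
  av S (p213 ∷ p1322 ∷ [])                     ∎
  where
  open ≡-Reasoning
  open Multiset S
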